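{- Let $n$, $k$, $t$ be positive integers with $k\geq t+1$ and $n\geq 2k+1+\delta_{2,q}(1-\delta_{k,t+1})$. Let $V$ be an $n$-dimensional vector space over $\mathbb{F}_q$. If $\mathcal{F}\subseteq {V\brack k}$ is an almost $t$-intersecting family of maximum size (among all almost $t$-intersecting subfamilies of ${V\brack k}$), then there exists $E\in {V\brack t}$ such that $\mathcal{F}=\{F\in {V\brack k}: E\subseteq F\}$.
   Context: $q$ is a prime power. For a vector space $W$ over $\mathbb{F}_q$ and an integer $k$, ${W\brack k}$ denotes the set of all $k$-dimensional subspaces of $W$. A family $\mathcal{F}\subseteq{V\brack k}$ is called almost $t$-intersecting if for each $F\in\mathcal{F}$ there is at most one $F'\in\mathcal{F}$ with $\dim(F\cap F')<t$. $\delta_{a,b}$ denotes the Kronecker delta (equal to $1$ if $a=b$ and $0$ otherwise). -}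

module Defs where

open import Algebra.Bundles using (CommutativeRing)
open import Algebra.Module.Bundles using (Module)
open import Data.Bool.Base using (if_then_else_)
open import Data.Fin.Base using (Fin)
open import Data.List.Base using (List; length)
open import Data.Nat.Base using (ℕ; _≤_; _<_; _^_; _≡ᵇ_)
open import Data.Nat.Primality using (Prime)
open import Data.Product.Base using (∃; ∃-syntax; ∃₂; _×_; _,_)
open import Data.Unit.Base using (tt)
open import Data.Vec.Functional using (Vector)
open import Function.Bundles using (Inverse)
open import Level using (Level; _⊔_; 0ℓ) renaming (suc to lsuc)
open import Relation.Binary.Bundles using (Setoid)
open import Relation.Binary.PropositionalEquality.Core using (_≡_)
open import Relation.Nullary.Negation.Core using (¬_)
open import Relation.Unary using (Pred; _∈_; _⊆_; _∩_; U)
open import Relation.Unary.Relation.Binary.Equality using (≐-setoid)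
import Algebra.Definitions.RawMonoid as RawMonoidDefs
import Data.List.Membership.Setoid as Membership
import Data.List.Relation.Unary.Unique.Setoid as Unique
import Relation.Binary.Construct.On as On
import Relation.Binary.PropositionalEquality.Properties as ≡

δ : ℕ → ℕ → ℕ
δ a b = if a ≡ᵇ b then 1 else 0

IsPrimePower : ℕ → Set
IsPrimePower q = ∃₂ λ p m → Prime p × 1 ≤ m × q ≡ p ^ m

record FiniteField (q : ℕ) (c ℓ : Level) : Set (lsuc (c ⊔ ℓ)) where
  field
    commutativeRing : CommutativeRing c ℓ
  open CommutativeRing commutativeRing public
  field
    0≉1         : ¬ (0# ≈ 1#)
    invertible  : ∀ x → ¬ (x ≈ 0#) → ∃[ y ] x * y ≈ 1#
    enumeration : Inverse setoid (≡.setoid (Fin q))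

module Subspaces
  {q : ℕ} {c ℓ m ℓm : Level}
  (K : FiniteField q c ℓ)
  (V : Module (FiniteField.commutativeRing K) m ℓm)
  where

  open FiniteField K using (_≈_; 0#) renaming (Carrier to Scalar)
  open Module V
  open RawMonoidDefs +ᴹ-rawMonoid using (sum)

  record Subspace (p : Level) : Set (c ⊔ m ⊔ ℓm ⊔ lsuc p) where
    field
      carrier   : Pred Carrierᴹ p
      resp-≈    : ∀ {x y} → x ≈ᴹ y → x ∈ carrier → y ∈ carrier
      0-closed  : 0ᴹ ∈ carrier
      +-closed  : ∀ {x y} → x ∈ carrier → y ∈ carrier → x +ᴹ y ∈ carrier
      *-closed  : ∀ a {x} → x ∈ carrier → a *ₗ x ∈ carrier

  open Subspace public

  whole : Subspace 0ℓ
  whole = record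
    { carrier  = U
    ; resp-≈   = λ _ _ → tt
    ; 0-closed = tt
    ; +-closed = λ _ _ → tt
    ; *-closed = λ _ _ → tt
    }

  infixr 7 _⊓_

  _⊓_ : ∀ {p} → Subspace p → Subspace p → Subspace p
  W ⊓ W′ = record
    { carrier  = carrier W ∩ carrier W′
    ; resp-≈   = λ e (x , x′) → resp-≈ W e x , resp-≈ W′ e x′
    ; 0-closed = 0-closed W , 0-closed W′
    ; +-closed = λ (x , x′) (y , y′) → +-closed W x y , +-closed W′ x′ y′
    ; *-closed = λ a (x , x′) → *-closed W a x , *-closed W′ a x′
    }

  linComb : ∀ {d} → Vector Scalar d → Vector Carrierᴹ d → Carrierᴹ
  linComb a b = sum (λ i → a i *ₗ b i)

  record IsBasis {p d} (W : Subspace p) (b : Vector Carrierᴹ d)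
                 : Set (c ⊔ ℓ ⊔ m ⊔ ℓm ⊔ p) where
    field
      members     : ∀ i → b i ∈ carrier W
      independent : ∀ a → linComb a b ≈ᴹ 0ᴹ → ∀ i → a i ≈ 0#
      spanning    : ∀ {x} → x ∈ carrier W → ∃[ a ] x ≈ᴹ linComb a b

  HasDim : ∀ {p} → Subspace p → ℕ → Set (c ⊔ ℓ ⊔ m ⊔ ℓm ⊔ p)
  HasDim W d = ∃ λ (b : Vector Carrierᴹ d) → IsBasis W b

  DimLess : ∀ {p} → Subspace p → ℕ → Set (c ⊔ ℓ ⊔ m ⊔ ℓm ⊔ p)
  DimLess W t = ∃[ d ] HasDim W d × d < t

  record Gr (p : Level) (k : ℕ) : Set (c ⊔ ℓ ⊔ m ⊔ ℓm ⊔ lsuc p) where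
    field
      subspace : Subspace p
      hasDim   : HasDim subspace k

  open Gr public

  infix 4 _≤ˢ_

  _≤ˢ_ : ∀ {p k l} → Gr p k → Gr p l → Set (m ⊔ p)
  E ≤ˢ F = carrier (subspace E) ⊆ carrier (subspace F)

  -- Two k-dimensional subspaces are equal when they have the same vectors;
  -- the basis witnessing the dimension is irrelevant.
  Gr-setoid : (p : Level) (k : ℕ) → Setoid (c ⊔ ℓ ⊔ m ⊔ ℓm ⊔ lsuc p) (m ⊔ p)
  Gr-setoid p k = On.setoid (≐-setoid Carrierᴹ p) (λ (F : Gr p k) → carrier (subspace F))

  -- There are only finitely many k-dimensional subspaces, so a family of them
  -- is given by a repetition-free list and its cardinality is the length.
  record Family (p : Level) (k : ℕ) : Set (c ⊔ ℓ ⊔ m ⊔ ℓm ⊔ lsuc p) where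
    field
      elements : List (Gr p k)
      unique   : Unique.Unique (Gr-setoid p k) elements

  open Family public

  infix 4 _∈ᶠ_

  _∈ᶠ_ : ∀ {p k} → Gr p k → Family p k → Set (c ⊔ ℓ ⊔ m ⊔ ℓm ⊔ lsuc p)
  _∈ᶠ_ {p} {k} F 𝓕 = Membership._∈_ (Gr-setoid p k) F (elements 𝓕)

  size : ∀ {p k} → Family p k → ℕ
  size 𝓕 = length (elements 𝓕)

  AlmostIntersecting : ∀ {p k} → ℕ → Family p k → Set (c ⊔ ℓ ⊔ m ⊔ ℓm ⊔ lsuc p)
  AlmostIntersecting {p} {k} t 𝓕 =
    ∀ {F F₁ F₂} → F ∈ᶠ 𝓕 → F₁ ∈ᶠ 𝓕 → F₂ ∈ᶠ 𝓕 →
    DimLess (subspace F ⊓ subspace F₁) t →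
    DimLess (subspace F ⊓ subspace F₂) t →
    Setoid._≈_ (Gr-setoid p k) F₁ F₂

  IsMaximumAlmostIntersecting :
    ∀ {p k} → ℕ → Family p k → Set (c ⊔ ℓ ⊔ m ⊔ ℓm ⊔ lsuc p)
  IsMaximumAlmostIntersecting {p} {k} t 𝓕 =
    AlmostIntersecting t 𝓕 ×
    (∀ (𝓖 : Family p k) → AlmostIntersecting t 𝓖 → size 𝓖 ≤ size 𝓕)

module Submission where

-- Everything is counted by vectors instead of by Gaussian coefficients: a subspace is a Boolean-valued function on the
-- q ^ n vectors.  Let N s be the number of k-spaces through a given s-space, so that a star has N t members and
-- N s ≥ q ^ (n - k) * N (s + 1).  Call W a cover of 𝓕 if it meets every member of 𝓕 in dimension at least t.  If an s-space
-- W is not a cover, witnessed by F, then all but one of the members through W contain one of the vectors of F outside W, and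
-- double counting these vectors bounds the number of members through W by 1 + a * X ≤ (a + 1) * X, where X is the bound for
-- (s + 1)-spaces and a = (q ^ (k - t + 1) - 1) / (q - 1).  Let τ ≤ k be the least dimension of a cover T (if there is none
-- below k, take T ∈ 𝓕, at the price of one exceptional member).  If τ > t, summing over the t-subspaces of T gives
-- ∣𝓕∣ ≤ 1 + [τ, t] * (a + 1) ^ (τ - t) * N τ.  The right-hand side does not increase with τ > t and is less than N t ≤ ∣𝓕∣
-- at τ = t + 1; for k = t + 1 only τ = t + 1 occurs, and n ≥ 2k + 1 is enough for q = 2 too.  Hence τ = t, that is, 𝓕 lies in a star.

open import Defs
open import Algebra.Module.Bundles using (Module)
open import Data.Nat.Base using (ℕ; _+_; _*_; _∸_; _≤_; _<_)
open import Data.Product.Base using (∃)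
open import Function.Bundles using (_⇔_)
open import Level using (Level)
open import Data.Bool.Base using (Bool; true; false; _∧_; not; T)
open import Data.Bool.Properties using (¬-not; ∧-comm) renaming (_≟_ to _≟ᵇ_)
open import Data.Empty using (⊥; ⊥-elim)
open import Data.Fin.Base using (Fin; zero; suc; finToFun; funToFin; combine)
open import Data.Fin.Properties
  using (_≟_; any?; all?; suc-injective; ¬∀⟶∃¬; finToFun-funToFin; funToFin-finToFin; 2↔Bool)
open import Data.List.Base using (lookup; tabulate; _∷_)
open import Data.List.Properties using (length-tabulate)
open import Data.List.Relation.Unary.All.Properties using (¬Any⇒All¬)
open import Data.List.Relation.Unary.Any as Any using (here; there)
open import Data.Nat.Base using (zero; suc; _^_; _/_; _≡ᵇ_; z≤n; s≤s; NonZero; >-nonZero)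
open import Data.Nat.DivMod using (m/n*n≤m; m*n/n≡m; /-monoˡ-≤)
open import Data.Nat.Induction using (<-rec)
open import Data.Nat.Tactic.RingSolver using (solve-∀)
open import Data.Product.Base using (_×_; _,_; proj₁; proj₂)
open import Data.Sum.Base using (_⊎_; inj₁; inj₂)
open import Data.Unit.Base using (tt)
open import Data.Vec.Functional using (Vector) renaming (_∷_ to _∷ᵛ_; [] to []ᵛ)
open import Function.Base using (_∘_)
open import Function.Bundles using (mk⇔; Inverse)
open import Level using (Lift; lift)
open import Relation.Binary.Bundles using (Setoid)
open import Relation.Binary.Definitions using (tri<; tri≈; tri>)
open import Relation.Binary.PropositionalEquality
  using (_≡_; _≗_; refl; sym; trans; cong; cong₂; subst; subst₂; module ≡-Reasoning)
open import Relation.Nullary using (¬_; Dec; yes; no; does; contradiction; _×-dec_)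
open import Relation.Nullary.Decidable using (dec-true; map′; _→-dec_)
import Algebra.Properties.CommutativeMonoid.Sum as Sum
import Algebra.Properties.Group as GroupProperties
import Algebra.Properties.Ring as RingProperties
import Algebra.Properties.Semiring.Sum as SemiringSum
import Data.List.Membership.Setoid.Properties as Membershipₚ
import Data.List.Relation.Unary.All as All
import Data.List.Relation.Unary.AllPairs as AllPairs
import Data.List.Relation.Unary.Any.Properties as Anyₚ
import Data.List.Relation.Unary.Unique.Setoid as Unique
import Data.List.Relation.Unary.Unique.Setoid.Properties as Uniqueₚ
import Data.Nat.Properties as ℕ
import Relation.Binary.Reasoning.Setoid as SetoidReasoning

open Sum ℕ.+-0-commutativeMonoid using (sum; ∑-comm; ∑-distrib-+; sum-cong-≗)
open SemiringSum ℕ.+-*-semiring using (*-distribʳ-sum)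

-- Cardinalities of subsets and double counting

∧-true : ∀ a {b} → a ∧ b ≡ true → a ≡ true × b ≡ true
∧-true true b = refl , b

∧-intro : ∀ {a b} → a ≡ true → b ≡ true → a ∧ b ≡ true
∧-intro refl refl = refl

not-true : ∀ a → not a ≡ true → a ≡ false
not-true false _ = refl

true≢false : ∀ {a} → a ≡ true → ¬ a ≡ false
true≢false refl ()

ind : Bool → ℕ
ind true  = 1
ind false = 0

card : ∀ {n} → (Fin n → Bool) → ℕ
card P = sum (ind ∘ P)

infix 4 _⊑_

_⊑_ : ∀ {n} → (Fin n → Bool) → (Fin n → Bool) → Set
P ⊑ Q = ∀ x → P x ≡ true → Q x ≡ true

_⊑?_ : ∀ {n} (P Q : Fin n → Bool) → Dec (P ⊑ Q)
P ⊑? Q = all? λ x → imp (P x) (Q x)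
  where
  imp : ∀ a b → Dec (a ≡ true → b ≡ true)
  imp false b     = yes λ ()
  imp true  true  = yes λ _ → refl
  imp true  false = no λ f → contradiction (f refl) λ ()

does-true : ∀ {a} {A : Set a} (A? : Dec A) → does A? ≡ true → A
does-true (yes a) _ = a

sum-mono-≤ : ∀ {n} (f g : Fin n → ℕ) → (∀ i → f i ≤ g i) → sum f ≤ sum g
sum-mono-≤ {zero}  f g f≤g = z≤n
sum-mono-≤ {suc n} f g f≤g = ℕ.+-mono-≤ (f≤g zero) (sum-mono-≤ (f ∘ suc) (g ∘ suc) (f≤g ∘ suc))

sum-zero : ∀ n → sum {n} (λ _ → 0) ≡ 0
sum-zero zero    = refl
sum-zero (suc n) = sum-zero n

ind-mono : ∀ {a b} → (a ≡ true → b ≡ true) → ind a ≤ ind b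
ind-mono {false} f = z≤n
ind-mono {true}  f rewrite f refl = ℕ.≤-refl

card-mono : ∀ {n} (P Q : Fin n → Bool) → P ⊑ Q → card P ≤ card Q
card-mono P Q P⊑Q = sum-mono-≤ (ind ∘ P) (ind ∘ Q) (λ x → ind-mono (P⊑Q x))

card-cong : ∀ {n} {P Q : Fin n → Bool} → P ≗ Q → card P ≡ card Q
card-cong P≗Q = sum-cong-≗ (cong ind ∘ P≗Q)

⊑-antisym : ∀ {n} {P Q : Fin n → Bool} → P ⊑ Q → Q ⊑ P → P ≗ Q
⊑-antisym {P = P} {Q} P⊑Q Q⊑P x with P x in p | Q x in q
... | true  | true  = refl
... | false | false = refl
... | true  | false = trans (sym (P⊑Q x p)) q
... | false | true  = trans (sym p) (Q⊑P x q)

card-true : ∀ n → card {n} (λ _ → true) ≡ n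
card-true zero    = refl
card-true (suc n) = cong suc (card-true n)

card-false : ∀ {n} {P : Fin n → Bool} → (∀ x → P x ≡ false) → card P ≡ 0
card-false {n} none = trans (card-cong none) (sum-zero n)

ind-split : ∀ a b → ind a ≡ ind (a ∧ b) + ind (a ∧ not b)
ind-split false _     = refl
ind-split true  true  = refl
ind-split true  false = refl

card-split : ∀ {n} (P Q : Fin n → Bool) →
  card P ≡ card (λ x → P x ∧ Q x) + card (λ x → P x ∧ not (Q x))
card-split P Q = trans (sum-cong-≗ (λ x → ind-split (P x) (Q x)))
                       (∑-distrib-+ (λ x → ind (P x ∧ Q x)) (λ x → ind (P x ∧ not (Q x))))

card≥1 : ∀ {n} (P : Fin n → Bool) x → P x ≡ true → 1 ≤ card P
card≥1 P zero    eq rewrite eq = s≤s z≤n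
card≥1 P (suc x) eq = ℕ.≤-trans (card≥1 (P ∘ suc) x eq) (ℕ.m≤n+m _ (ind (P zero)))

card≤1 : ∀ {n} (P : Fin n → Bool) → (∀ x y → P x ≡ true → P y ≡ true → x ≡ y) → card P ≤ 1
card≤1 {zero}  P _ = z≤n
card≤1 {suc n} P unique with P zero in eq
... | false = card≤1 (P ∘ suc) (λ x y p q → suc-injective (unique (suc x) (suc y) p q))
... | true  = ℕ.≤-reflexive (cong suc (card-false none))
  where
  none : ∀ x → P (suc x) ≡ false
  none x = ¬-not λ p → contradiction (unique zero (suc x) eq p) λ ()

-- A point of `Q` outside `P` would give `card P + 1 ≤ card Q`. This turns an inclusion of subspaces
-- of equal size into an equality.
⊑-reverse : ∀ {n} (P Q : Fin n → Bool) → P ⊑ Q → card Q ≤ card P → Q ⊑ P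
⊑-reverse P Q P⊑Q Q≤P x Qx with P x in eq
... | true  = refl
... | false = contradiction (begin-strict
    card P                                          <⟨ ℕ.n<1+n _ ⟩
    1 + card P                                      ≡⟨ ℕ.+-comm 1 _ ⟩
    card P + 1                                      ≤⟨ ℕ.+-mono-≤
      (card-mono P (λ y → Q y ∧ P y) λ y Py → ∧-intro (P⊑Q y Py) Py)
                                                        (card≥1 (λ y → Q y ∧ not (P y)) x (∧-intro Qx (cong not eq))) ⟩
    card (λ y → Q y ∧ P y) + card (λ y → Q y ∧ not (P y)) ≡⟨ card-split Q P ⟨
    card Q                                          ∎) (ℕ.≤⇒≯ Q≤P)
  where open ℕ.≤-Reasoning

-- Both sides bound the number of pairs `(i , x)` with `A i`, `P x` and `R i x`, counted by rows and
-- by columns.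
double-count : ∀ {m n a b} (A : Fin m → Bool) (P : Fin n → Bool) (R : Fin m → Fin n → Bool) →
  (∀ i → A i ≡ true → a ≤ card (λ x → P x ∧ R i x)) →
  (∀ x → P x ≡ true → card (λ i → A i ∧ R i x) ≤ b) →
  card A * a ≤ card P * b
double-count {m} {n} {a} {b} A P R lower upper = begin
  card A * a                                        ≡⟨ *-distribʳ-sum a (ind ∘ A) ⟩
  sum (λ i → ind (A i) * a)                         ≤⟨ sum-mono-≤ _ (λ i → sum (λ x → incidence i x)) row ⟩
  sum (λ i → sum (λ x → incidence i x))             ≡⟨ ∑-comm incidence ⟩
  sum (λ x → sum (λ i → incidence i x))             ≤⟨ sum-mono-≤ (λ x → sum (λ i → incidence i x)) _ column ⟩
  sum (λ x → ind (P x) * b)                         ≡⟨ *-distribʳ-sum b (ind ∘ P) ⟨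
  card P * b                                        ∎
  where
  open ℕ.≤-Reasoning
  incidence : Fin m → Fin n → ℕ
  incidence i x = ind (A i ∧ (P x ∧ R i x))
  row : ∀ i → ind (A i) * a ≤ sum (λ x → incidence i x)
  row i with A i in eq
  ... | false = z≤n
  ... | true  = ℕ.≤-trans (ℕ.≤-reflexive (ℕ.+-identityʳ a)) (lower i eq)
  column : ∀ x → sum (λ i → incidence i x) ≤ ind (P x) * b
  column x with P x in eq
  ... | true  = ℕ.≤-trans (upper x eq) (ℕ.≤-reflexive (sym (ℕ.+-identityʳ b)))
  ... | false = ℕ.≤-reflexive (card-false {P = λ i → A i ∧ false} (λ i → trans (∧-comm (A i) false) refl))

-- Surjectivity gives `card P ≤ m` and injectivity `m ≤ card P`, each by double counting the graph
-- of `g` with both constants 1.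
image-card : ∀ {m n} (g : Fin m → Fin n) (P : Fin n → Bool) →
  (∀ {i j} → g i ≡ g j → i ≡ j) → (∀ i → P (g i) ≡ true) → (∀ x → P x ≡ true → ∃ λ i → g i ≡ x) →
  card P ≡ m
image-card {m} {n} g P inj into onto = ℕ.≤-antisym
  (subst₂ _≤_ (ℕ.*-identityʳ _) (trans (ℕ.*-identityʳ _) (card-true m))
    (double-count {a = 1} {b = 1} P (λ _ → true) (λ x i → does (g i ≟ x))
      (λ x Px → let (i , e) = onto x Px in card≥1 (λ i → does (g i ≟ x)) i (dec-true (g i ≟ x) e))
      (λ i _ → card≤1 _ λ x y p q →
        trans (sym (does-true (g i ≟ x) (proj₂ (∧-true (P x) p)))) (does-true (g i ≟ y) (proj₂ (∧-true (P y) q))))))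
  (subst₂ _≤_ (trans (ℕ.*-identityʳ _) (card-true m)) (ℕ.*-identityʳ _)
    (double-count {a = 1} {b = 1} (λ _ → true) P (λ i x → does (g i ≟ x))
      (λ i _ → card≥1 (λ x → P x ∧ does (g i ≟ x)) (g i) (∧-intro (into i) (dec-true (g i ≟ g i) refl)))
      (λ x _ → card≤1 _ λ i j p q → inj (trans (does-true (g i ≟ x) p) (sym (does-true (g j ≟ x) q))))))

-- Numerical estimates

*≤⇒≤/ : ∀ {a b} c .{{_ : NonZero c}} → a * c ≤ b → a ≤ b / c
*≤⇒≤/ {a} c ac≤b = subst (_≤ _) (m*n/n≡m a c) (/-monoˡ-≤ c ac≤b)

-- The parameter is r = q - 1, so that the factor q - 1 is a variable for the ring solver.
module Powers (r : ℕ) where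

  q : ℕ
  q = suc r

  -- The number (q ^ d - 1) / (q - 1) of 1-dimensional subspaces of a d-space.
  geo : ℕ → ℕ
  geo zero    = 0
  geo (suc d) = 1 + q * geo d

  geo-closed : ∀ d → r * geo d + 1 ≡ q ^ d
  geo-closed zero    = cong (_+ 1) (ℕ.*-zeroʳ r)
  geo-closed (suc d) = trans (identity r (geo d)) (cong (q *_) (geo-closed d))
    where
    identity : ∀ r g → r * (1 + suc r * g) + 1 ≡ suc r * (r * g + 1)
    identity = solve-∀

  geo-mono : ∀ {d e} → d ≤ e → geo d ≤ geo e
  geo-mono z≤n     = z≤n
  geo-mono (s≤s p) = s≤s (ℕ.*-monoʳ-≤ q (geo-mono p))

  -- The number of vectors of an m-space outside a given s-subspace.
  gap : ℕ → ℕ → ℕ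
  gap m s = q ^ m ∸ q ^ s

  gap-shift : ∀ s d → gap (d + s) s ≡ r * geo d * q ^ s
  gap-shift s d = begin
    q ^ (d + s) ∸ q ^ s                       ≡⟨ cong (_∸ q ^ s) (ℕ.^-distribˡ-+-* q d s) ⟩
    q ^ d * q ^ s ∸ q ^ s                     ≡⟨ cong (λ z → z * q ^ s ∸ q ^ s) (geo-closed d) ⟨
    (r * geo d + 1) * q ^ s ∸ q ^ s           ≡⟨ cong (_∸ q ^ s) (ℕ.*-distribʳ-+ (q ^ s) (r * geo d) 1) ⟩
    (r * geo d * q ^ s + 1 * q ^ s) ∸ q ^ s   ≡⟨ cong (λ z → (r * geo d * q ^ s + z) ∸ q ^ s) (ℕ.*-identityˡ (q ^ s)) ⟩
    (r * geo d * q ^ s + q ^ s) ∸ q ^ s       ≡⟨ ℕ.m+n∸n≡m (r * geo d * q ^ s) (q ^ s) ⟩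
    r * geo d * q ^ s                         ∎
    where open ≡-Reasoning

  gap-suc : ∀ s m → gap (suc m) (suc s) ≡ q * gap m s
  gap-suc s m = sym (ℕ.*-distribˡ-∸ q (q ^ m) (q ^ s))

  -- The number of ways to extend a basis of an s-subspace of an m-space by `d` further independent
  -- vectors, in order. Inequalities on Gaussian coefficients are stated through these products,
  -- cleared of denominators.
  falling : ℕ → ℕ → ℕ → ℕ
  falling m s zero    = 1
  falling m s (suc d) = gap m s * falling m (suc s) d

  falling-snoc : ∀ m s d → falling m s (suc d) ≡ falling m s d * gap m (s + d)
  falling-snoc m s zero    = trans (ℕ.*-comm (gap m s) 1) (cong (λ z → 1 * gap m z) (sym (ℕ.+-identityʳ s)))
  falling-snoc m s (suc d) = begin
    gap m s * falling m (suc s) (suc d)                   ≡⟨ cong (gap m s *_) (falling-snoc m (suc s) d) ⟩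
    gap m s * (falling m (suc s) d * gap m (suc s + d))   ≡⟨ ℕ.*-assoc (gap m s) (falling m (suc s) d) _ ⟨
    gap m s * falling m (suc s) d * gap m (suc s + d)     ≡⟨ cong (λ z → falling m s (suc d) * gap m z) (ℕ.+-suc s d) ⟨
    falling m s (suc d) * gap m (s + suc d)               ∎
    where open ≡-Reasoning

  falling-shift : ∀ m s d → falling (suc m) (suc s) d ≡ q ^ d * falling m s d
  falling-shift m s zero    = refl
  falling-shift m s (suc d) = begin
    gap (suc m) (suc s) * falling (suc m) (suc (suc s)) d ≡⟨ cong₂ _*_ (gap-suc s m) (falling-shift m (suc s) d) ⟩
    q * gap m s * (q ^ d * falling m (suc s) d)           ≡⟨ identity q (gap m s) (q ^ d) (falling m (suc s) d) ⟩
    q * q ^ d * (gap m s * falling m (suc s) d)           ∎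
    where
    open ≡-Reasoning
    identity : ∀ a b c e → a * b * (c * e) ≡ a * c * (b * e)
    identity = solve-∀

  module _ (1≤r : 1 ≤ r) where

    1<q : 1 < q
    1<q = s≤s 1≤r

    q^>0 : ∀ m → 0 < q ^ m
    q^>0 m = ℕ.m^n>0 q m

    ^-injective : ∀ {d e} → q ^ d ≡ q ^ e → d ≡ e
    ^-injective {d} {e} eq with ℕ.<-cmp d e
    ... | tri≈ _ d≡e _ = d≡e
    ... | tri< d<e _ _ = contradiction eq (ℕ.<⇒≢ (ℕ.^-monoʳ-< q 1<q d<e))
    ... | tri> _ _ e<d = contradiction (sym eq) (ℕ.<⇒≢ (ℕ.^-monoʳ-< q 1<q e<d))

    gap>0 : ∀ {s m} → s < m → 0 < gap m s
    gap>0 s<m = ℕ.m<n⇒0<n∸m (ℕ.^-monoʳ-< q 1<q s<m)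

    falling>0 : ∀ m s d → s + d ≤ m → 0 < falling m s d
    falling>0 m s zero    _ = s≤s z≤n
    falling>0 m s (suc d) s+d≤m = ℕ.*-mono-≤
      (gap>0 (ℕ.≤-trans (ℕ.≤-trans (s≤s (ℕ.m≤m+n s d)) (ℕ.≤-reflexive (sym (ℕ.+-suc s d)))) s+d≤m))
      (falling>0 m (suc s) d (ℕ.≤-trans (ℕ.≤-reflexive (sym (ℕ.+-suc s d))) s+d≤m))

    -- The number of t-subspaces of a τ-space is falling τ 0 t / falling t 0 t.
    falling-ratio : ∀ {Q b} t τ → t ≤ τ → q ^ suc t * b ≤ r * Q →
      falling (suc τ) 0 t * b ≤ falling τ 0 t * Q
    falling-ratio {Q} {b} t τ t≤τ hyp =
      -- The factor `gap (suc τ) t` completes `C (suc τ)` to a product of `suc t` gaps; taking out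
      -- its first factor and shifting the others produces `C τ`.
      ℕ.*-cancelʳ-≤ (C (suc τ) * b) (C τ * Q) (q * gap (suc τ) t)
        {{>-nonZero (ℕ.*-mono-≤ (s≤s {n = r} z≤n) (gap>0 (s≤s t≤τ)))}} (begin
      C (suc τ) * b * (q * gap (suc τ) t)         ≡⟨ assoc₁ (C (suc τ)) b q (gap (suc τ) t) ⟩
      C (suc τ) * gap (suc τ) t * (q * b)         ≡⟨ cong (_* (q * b)) (falling-snoc (suc τ) 0 t) ⟨
      gap (suc τ) 0 * falling (suc τ) 1 t * (q * b) ≡⟨ cong (λ z → gap (suc τ) 0 * z * (q * b)) (falling-shift τ 0 t) ⟩
      gap (suc τ) 0 * (q ^ t * C τ) * (q * b)     ≤⟨ ℕ.*-monoˡ-≤ (q * b)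
        (ℕ.*-monoˡ-≤ (q ^ t * C τ) (ℕ.m∸n≤m (q ^ suc τ) 1)) ⟩
      q ^ suc τ * (q ^ t * C τ) * (q * b)         ≡⟨ assoc₂ (q ^ suc τ) (q ^ t) (C τ) q b ⟩
      C τ * q ^ suc τ * (q * q ^ t * b)           ≤⟨ ℕ.*-monoʳ-≤ (C τ * q ^ suc τ) hyp ⟩
      C τ * q ^ suc τ * (r * Q)                   ≡⟨ assoc₃ (C τ) (q ^ suc τ) r Q ⟩
      C τ * Q * (q ^ suc τ * r)                   ≤⟨ ℕ.*-monoʳ-≤ (C τ * Q) bound ⟩
      C τ * Q * (q * gap (suc τ) t)               ∎)
      where
      open ℕ.≤-Reasoning
      C : ℕ → ℕ
      C m = falling m 0 t
      assoc₁ : ∀ a b c d → a * b * (c * d) ≡ a * d * (c * b)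
      assoc₁ = solve-∀
      assoc₂ : ∀ a b c d e → a * (b * c) * (d * e) ≡ c * a * (d * b * e)
      assoc₂ = solve-∀
      assoc₃ : ∀ a b c d → a * b * (c * d) ≡ a * d * (b * c)
      assoc₃ = solve-∀
      -- q ^ (τ + 1) * (q - 1) is q ^ (τ + 2) - q ^ (τ + 1), and t ≤ τ allows lowering the
      -- subtracted exponent to t + 1.
      bound : q ^ suc τ * r ≤ q * gap (suc τ) t
      bound = begin
        q ^ suc τ * r                   ≡⟨ ℕ.m+n∸n≡m (q ^ suc τ * r) (q ^ suc τ) ⟨
        q ^ suc τ * r + q ^ suc τ ∸ q ^ suc τ ≡⟨ cong (_∸ q ^ suc τ) (factor (q ^ suc τ) r) ⟩
        q * q ^ suc τ ∸ q ^ suc τ       ≤⟨ ℕ.∸-monoʳ-≤ (q * q ^ suc τ) (ℕ.^-monoʳ-≤ q (s≤s t≤τ)) ⟩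
        q * q ^ suc τ ∸ q * q ^ t       ≡⟨ ℕ.*-distribˡ-∸ q (q ^ suc τ) (q ^ t) ⟨
        q * gap (suc τ) t               ∎
        where
        factor : ∀ a r → a * r + a ≡ suc r * a
        factor = solve-∀

    sum-exponent : ∀ {k t} → suc t ≤ k → q ^ suc t * q ^ suc (k ∸ t) ≡ q ^ (2 + k)
    sum-exponent {k} {t} t<k = trans (sym (ℕ.^-distribˡ-+-* q (suc t) (suc (k ∸ t))))
      (cong (q ^_) (cong suc (trans (ℕ.+-suc t (k ∸ t)) (cong suc (ℕ.m+[n∸m]≡n (ℕ.≤-trans (ℕ.n≤1+n t) t<k))))))

    -- With m = k - t + 1, (q - 1) * (1 + geo m) = q ^ m + q - 2. For q = 2 the left side is exactly
    -- q ^ (k + 2), which needs n ≥ 2k + 2; for q > 2 the factor (q - 1) ^ 2 gained on the right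
    -- makes n ≥ 2k + 1 enough.
    wide-condition : ∀ n k t → suc t ≤ k → (1 < r × 2 * k + 1 ≤ n) ⊎ (r ≡ 1 × 2 * k + 2 ≤ n) →
      q ^ suc t * (1 + geo (suc (k ∸ t))) ≤ r * q ^ (n ∸ k)
    wide-condition n k t t<k (inj₁ (s≤s (s≤s {n = u} _) , 2k<n)) = ℕ.*-cancelˡ-≤ r (begin
      r * (q ^ suc t * (1 + geo m))                     ≡⟨ expand u (q ^ suc t) (geo m) ⟩
      q ^ suc t * ((r * geo m + 1) + suc u)             ≡⟨ cong (λ z → q ^ suc t * (z + suc u)) (geo-closed m) ⟩
      q ^ suc t * (q ^ m + suc u)                       ≡⟨ ℕ.*-distribˡ-+ (q ^ suc t) (q ^ m) (suc u) ⟩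
      q ^ suc t * q ^ m + q ^ suc t * suc u             ≤⟨ ℕ.+-mono-≤ (ℕ.≤-reflexive (sum-exponent t<k))
        (ℕ.*-monoˡ-≤ (suc u) (ℕ.^-monoʳ-≤ q t<k)) ⟩
      q * (q * q ^ k) + q ^ k * suc u                   ≤⟨ ℕ.m≤m+n _ _ ⟩
      -- The added polynomial is (q - 1) ^ 2 * q - q ^ 2 - (q - 2), expanded in u = q - 3, where all
      -- coefficients are positive.
      q * (q * q ^ k) + q ^ k * suc u + q ^ k * (2 + 9 * u + 6 * u * u + u * u * u) ≡⟨ collect u (q ^ k) ⟩
      r * (r * q ^ suc k)                               ≤⟨ ℕ.*-monoʳ-≤ r
        (ℕ.*-monoʳ-≤ r (ℕ.^-monoʳ-≤ q (ℕ.m+n≤o⇒m≤o∸n (suc k) (ℕ.≤-trans (ℕ.≤-reflexive (shape k)) 2k<n)))) ⟩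
      r * (r * q ^ (n ∸ k))                             ∎)
      where
      open ℕ.≤-Reasoning
      m : ℕ
      m = suc (k ∸ t)
      expand : ∀ u p g → (2 + u) * (p * (1 + g)) ≡ p * (((2 + u) * g + 1) + suc u)
      expand = solve-∀
      collect : ∀ u z → (3 + u) * ((3 + u) * z) + z * suc u + z * (2 + 9 * u + 6 * u * u + u * u * u) ≡ (2 + u) *
        ((2 + u) * ((3 + u) * z))
      collect = solve-∀
      shape : ∀ k → suc k + k ≡ 2 * k + 1
      shape = solve-∀
    wide-condition n k t t<k (inj₂ (refl , 2k+2≤n)) = begin
      q ^ suc t * (1 + geo (suc (k ∸ t)))       ≡⟨ cong (q ^ suc t *_)
        (trans (unit (geo (suc (k ∸ t)))) (geo-closed (suc (k ∸ t)))) ⟩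
      q ^ suc t * q ^ suc (k ∸ t)               ≡⟨ sum-exponent t<k ⟩
      q ^ (2 + k)                               ≤⟨ ℕ.^-monoʳ-≤ q
        (ℕ.m+n≤o⇒m≤o∸n (2 + k) (ℕ.≤-trans (ℕ.≤-reflexive (shape k)) 2k+2≤n)) ⟩
      q ^ (n ∸ k)                               ≡⟨ ℕ.*-identityˡ _ ⟨
      1 * q ^ (n ∸ k)                           ∎
      where
      open ℕ.≤-Reasoning
      unit : ∀ g → 1 + g ≡ 1 * g + 1
      unit = solve-∀
      shape : ∀ k → 2 + k + k ≡ 2 * k + 2
      shape = solve-∀

    -- The number of k-spaces through an s-space, and the final inequalities

    module Counts (n k : ℕ) (k≤n : k ≤ n) where

      Q : ℕ
      Q = q ^ (n ∸ k)

      -- For d = k - s, the number of k-spaces through an s-space.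
      -- Divisions are rounded down at each step; the actual quotients are integral, but this is not needed.
      -- The divisor is q ^ k - q ^ s as soon as s < k.
      supers : ℕ → ℕ → ℕ
      supers s zero    = 1
      supers s (suc d) = gap n s * supers (suc s) d / suc (gap k s ∸ 1)

      private
        divisor : ∀ {s} → s < k → suc (gap k s ∸ 1) ≡ gap k s
        divisor s<k = ℕ.m+[n∸m]≡n (gap>0 s<k)

      supers-lower : ∀ {c} s d → s < k → c * gap k s ≤ gap n s * supers (suc s) d → c ≤ supers s (suc d)
      supers-lower {c} s d s<k le = *≤⇒≤/ (suc (gap k s ∸ 1))
        (subst (λ z → c * z ≤ gap n s * supers (suc s) d) (sym (divisor s<k)) le)

      supers-upper : ∀ s d → s < k → supers s (suc d) * gap k s ≤ gap n s * supers (suc s) d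
      supers-upper s d s<k = subst (λ z → supers s (suc d) * z ≤ gap n s * supers (suc s) d) (divisor s<k)
        (m/n*n≤m (gap n s * supers (suc s) d) (suc (gap k s ∸ 1)))

      -- Since Q * (q ^ k - q ^ s) = q ^ n - Q * q ^ s and Q ≥ 1, `gap n s` is at least
      -- `Q * gap k s`.
      supers-step : ∀ s d → s < k → Q * supers (suc s) d ≤ supers s (suc d)
      supers-step s d s<k = supers-lower s d s<k (begin
        Q * supers (suc s) d * gap k s          ≡⟨ swap Q (supers (suc s) d) (gap k s) ⟩
        Q * gap k s * supers (suc s) d          ≡⟨ cong (_* supers (suc s) d) (ℕ.*-distribˡ-∸ Q (q ^ k) (q ^ s)) ⟩
        (Q * q ^ k ∸ Q * q ^ s) * supers (suc s) d ≤⟨ ℕ.*-monoˡ-≤ (supers (suc s) d) (ℕ.∸-mono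
                                                     (ℕ.≤-reflexive (trans (sym (ℕ.^-distribˡ-+-* q (n ∸ k) k))
                                                       (cong (q ^_) (ℕ.m∸n+n≡m k≤n))))
                                                     (subst (_≤ Q * q ^ s) (ℕ.*-identityˡ (q ^ s))
                                                       (ℕ.*-monoˡ-≤ (q ^ s) (q^>0 (n ∸ k))))) ⟩
        gap n s * supers (suc s) d              ∎)
        where
        open ℕ.≤-Reasoning
        swap : ∀ a b c → a * b * c ≡ a * c * b
        swap = solve-∀

      supers≥1 : ∀ s d → s + d ≡ k → 1 ≤ supers s d
      supers≥1 s zero    _    = ℕ.≤-refl
      supers≥1 s (suc d) refl = ℕ.≤-trans
        (ℕ.*-mono-≤ (q^>0 (n ∸ k)) (supers≥1 (suc s) d (sym (ℕ.+-suc s d))))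
        (supers-step s d (ℕ.m<m+n s (s≤s z≤n)))

      -- Here g stands for the number of members that meet a smallest cover, of dimension t + 1 + j, in dimension at least t.
      module Contradiction (t : ℕ) (b : ℕ) where

        -- Raising the dimension of the cover by one multiplies the first factor by at most Q / b
        -- (`falling-ratio`), gains one factor `b`, and divides the number of k-spaces by at least
        -- `Q` (`supers-step`). So the bound is largest at dimension t + 1.
        telescope : q ^ suc t * b ≤ r * Q → ∀ j d → suc t + j + d ≡ k →
          falling (suc t + j) 0 t * (b ^ suc j * supers (suc t + j) d) ≤
          falling (suc t) 0 t * (b * supers (suc t) (j + d))
        telescope hyp zero    d refl rewrite ℕ.+-identityʳ t | ℕ.*-identityʳ b = ℕ.≤-refl
        telescope hyp (suc j) d refl = begin
          C (suc t + suc j) * (b ^ suc (suc j) * S (suc t + suc j) d)   ≡⟨ cong (λ z → C z * (b ^ suc (suc j) * S z d))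
            (ℕ.+-suc (suc t) j) ⟩
          C (suc σ) * (b * b ^ suc j * S (suc σ) d)                     ≡⟨ assoc₁ (C (suc σ)) b (b ^ suc j)
            (S (suc σ) d) ⟩
          C (suc σ) * b * (b ^ suc j * S (suc σ) d)                     ≤⟨ ℕ.*-monoˡ-≤ (b ^ suc j * S (suc σ) d)
            (falling-ratio t σ (ℕ.≤-trans (ℕ.n≤1+n t) (ℕ.m≤m+n (suc t) j)) hyp) ⟩
          C σ * Q * (b ^ suc j * S (suc σ) d)                           ≡⟨ assoc₂ (C σ) Q (b ^ suc j) (S (suc σ) d) ⟩
          C σ * (b ^ suc j * (Q * S (suc σ) d))                         ≤⟨ ℕ.*-monoʳ-≤ (C σ)
            (ℕ.*-monoʳ-≤ (b ^ suc j) (supers-step σ d σ<k)) ⟩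
          C σ * (b ^ suc j * S σ (suc d))                               ≤⟨ telescope hyp j (suc d) σ+1+d ⟩
          C (suc t) * (b * S (suc t) (j + suc d))                       ≡⟨ cong (λ z → C (suc t) * (b * S (suc t) z))
            (ℕ.+-suc j d) ⟩
          C (suc t) * (b * S (suc t) (suc j + d))                       ∎
          where
          open ℕ.≤-Reasoning
          C : ℕ → ℕ
          C m = falling m 0 t
          S : ℕ → ℕ → ℕ
          S = supers
          σ : ℕ
          σ = suc t + j
          σ+1+d : σ + suc d ≡ suc t + suc j + d
          σ+1+d = trans (ℕ.+-suc σ d) (cong (_+ d) (sym (ℕ.+-suc (suc t) j)))
          σ<k : σ < suc t + suc j + d
          σ<k = subst (suc σ ≤_) σ+1+d (ℕ.m<m+n σ (s≤s z≤n))
          assoc₁ : ∀ a b c d → a * (b * c * d) ≡ a * b * (c * d)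
          assoc₁ = solve-∀
          assoc₂ : ∀ a b c d → a * b * (c * d) ≡ a * (c * (b * d))
          assoc₂ = solve-∀

        -- The quotient of `falling (suc t) 0 t` by `falling t 0 t` is the number `geo (suc t)` of
        -- hyperplanes of a (t + 1)-space; multiplying by `gap (suc t) t`, which is (q - 1) * q ^ t,
        -- makes this an identity of products.
        cancel-falling : ∀ {g X} → g * falling t 0 t ≤ falling (suc t) 0 t * (b * X) → g ≤ geo (suc t) * (b * X)
        cancel-falling {g} {X} hyp = ℕ.*-cancelʳ-≤ g (geo (suc t) * (b * X)) (D * gap (suc t) t)
          {{>-nonZero (ℕ.*-mono-≤ (falling>0 t 0 t ℕ.≤-refl) (gap>0 (ℕ.n<1+n t)))}} (begin
          g * (D * gap (suc t) t)                                   ≡⟨ ℕ.*-assoc g D (gap (suc t) t) ⟨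
          g * D * gap (suc t) t                                     ≤⟨ ℕ.*-monoˡ-≤ (gap (suc t) t) hyp ⟩
          falling (suc t) 0 t * (b * X) * gap (suc t) t             ≡⟨ swap (falling (suc t) 0 t) (b * X)
            (gap (suc t) t) ⟩
          falling (suc t) 0 t * gap (suc t) t * (b * X)             ≡⟨ cong (_* (b * X)) (falling-snoc (suc t) 0 t) ⟨
          gap (suc t) 0 * falling (suc t) 1 t * (b * X)             ≡⟨ cong (λ z → gap (suc t) 0 * z * (b * X))
            (falling-shift t 0 t) ⟩
          gap (suc t) 0 * (q ^ t * D) * (b * X)                     ≡⟨ cong (λ z → z * (q ^ t * D) * (b * X))
            (trans (cong (λ z → gap z 0) (sym (ℕ.+-identityʳ (suc t)))) (gap-shift 0 (suc t))) ⟩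
          r * geo (suc t) * 1 * (q ^ t * D) * (b * X)               ≡⟨ rearrange r (geo (suc t)) (q ^ t) D (b * X) ⟩
          geo (suc t) * (b * X) * (D * (r * 1 * q ^ t))             ≡⟨ cong
            (λ z → geo (suc t) * (b * X) * (D * (r * z * q ^ t))) geo-1 ⟨
          geo (suc t) * (b * X) * (D * (r * geo 1 * q ^ t))         ≡⟨ cong (λ z → geo (suc t) * (b * X) * (D * z))
            (gap-shift t 1) ⟨
          geo (suc t) * (b * X) * (D * gap (suc t) t)               ∎)
          where
          open ℕ.≤-Reasoning
          D : ℕ
          D = falling t 0 t
          geo-1 : geo 1 ≡ 1
          geo-1 = cong suc (ℕ.*-zeroʳ q)
          swap : ∀ a b c → a * b * c ≡ a * c * b
          swap = solve-∀
          rearrange : ∀ r g p D x → r * g * 1 * (p * D) * x ≡ g * x * (D * (r * 1 * p))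
          rearrange = solve-∀

        -- Adding b * X to r * g ≤ r * geo (t + 1) * b * X gives at most q ^ (t + 1) * b * X ≤ r * Q
        -- * X ≤ r * (1 + g). Hence b * X ≤ r < q, against q < b and X ≥ 1.
        wide : ∀ {g} → q ^ suc t * b ≤ r * Q → q < b → ∀ j d → suc t + j + d ≡ k →
          g * falling t 0 t ≤ falling (suc t + j) 0 t * (b ^ suc j * supers (suc t + j) d) →
          supers t (suc j + d) ≤ 1 + g → ⊥
        wide {g} hyp q<b j d eq count M≤ = ℕ.<⇒≱ q<b (begin
          b                     ≡⟨ ℕ.*-identityʳ b ⟨
          b * 1                 ≤⟨ ℕ.*-monoʳ-≤ b (supers≥1 (suc t) (j + d) eq′) ⟩
          b * X                 ≤⟨ ℕ.+-cancelˡ-≤ (r * g) (b * X) r chain ⟩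
          r                     ≤⟨ ℕ.n≤1+n r ⟩
          q                     ∎)
          where
          open ℕ.≤-Reasoning
          eq′ : suc t + (j + d) ≡ k
          eq′ = trans (sym (ℕ.+-assoc (suc t) j d)) eq
          X : ℕ
          X = supers (suc t) (j + d)
          g≤ : g ≤ geo (suc t) * (b * X)
          g≤ = cancel-falling {X = X} (ℕ.≤-trans count (telescope hyp j d eq))
          chain : r * g + b * X ≤ r * g + r
          chain = begin
            r * g + b * X                         ≤⟨ ℕ.+-monoˡ-≤ (b * X) (ℕ.*-monoʳ-≤ r g≤) ⟩
            r * (geo (suc t) * (b * X)) + b * X   ≡⟨ factor r (geo (suc t)) (b * X) ⟩
            (r * geo (suc t) + 1) * (b * X)       ≡⟨ cong (_* (b * X)) (geo-closed (suc t)) ⟩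
            q ^ suc t * (b * X)                   ≡⟨ ℕ.*-assoc (q ^ suc t) b X ⟨
            q ^ suc t * b * X                     ≤⟨ ℕ.*-monoˡ-≤ X hyp ⟩
            r * Q * X                             ≡⟨ ℕ.*-assoc r Q X ⟩
            r * (Q * X)                           ≤⟨ ℕ.*-monoʳ-≤ r
              (supers-step t (j + d) (subst (t <_) eq′ (s≤s (ℕ.m≤m+n t (j + d))))) ⟩
            r * supers t (suc j + d)              ≤⟨ ℕ.*-monoʳ-≤ r M≤ ⟩
            r * (1 + g)                           ≡⟨ factor′ r g ⟩
            r * g + r                             ∎
            where
            factor : ∀ r g x → r * (g * x) + x ≡ (r * g + 1) * x
            factor = solve-∀
            factor′ : ∀ r g → r * (1 + g) ≡ r * g + r
            factor′ = solve-∀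

        -- `supers t 1` is at least `geo (n ∸ t)`, hence at least 1 + q + q ^ 2 * geo k, whereas b =
        -- q + 2 gives g ≤ (q + 2) * geo k ≤ q ^ 2 * geo k. This leaves no room for
        -- `supers t 1 ≤ 1 + g`.
        narrow : ∀ {g} → suc t ≡ k → 2 * k + 1 ≤ n → b ≡ 1 + geo 2 →
          g * falling t 0 t ≤ falling (suc t) 0 t * (b * 1) → supers t 1 ≤ 1 + g → ⊥
        narrow {g} refl 2k<n refl count M≤ = ℕ.<⇒≱ (s≤s 1≤r) (ℕ.+-cancelˡ-≤ (q * q * G) q 1 (begin
          q * q * G + q           ≤⟨ ℕ.≤-pred (begin
              suc (q * q * G + q)       ≡⟨ unfold q G ⟩
              geo (2 + k)               ≤⟨ geo-mono (ℕ.m+n≤o⇒m≤o∸n (2 + k) (ℕ.≤-trans (ℕ.≤-reflexive shape) 2k<n)) ⟩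
              geo (n ∸ t)               ≤⟨ supers-lower t 0 (ℕ.n<1+n t) (ℕ.≤-reflexive exact) ⟩
              supers t 1                ≤⟨ M≤ ⟩
              suc g                     ∎) ⟩
          g                       ≤⟨ cancel-falling {X = 1} count ⟩
          G * ((1 + geo 2) * 1)   ≡⟨ value q G ⟩
          (2 + q) * G             ≤⟨ ℕ.*-monoˡ-≤ G (ℕ.+-monoˡ-≤ q (s≤s 1≤r)) ⟩
          (q + q) * G             ≡⟨ double q G ⟩
          2 * q * G               ≤⟨ ℕ.*-monoˡ-≤ G (ℕ.*-monoˡ-≤ q (s≤s 1≤r)) ⟩
          q * q * G               ≤⟨ ℕ.m≤m+n _ 1 ⟩
          q * q * G + 1           ∎))
          where
          open ℕ.≤-Reasoning
          G : ℕ
          G = geo k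
          unfold : ∀ q G → suc (q * q * G + q) ≡ 1 + q * (1 + q * G)
          unfold = solve-∀
          value : ∀ q G → G * ((1 + (1 + q * (1 + q * 0))) * 1) ≡ (2 + q) * G
          value = solve-∀
          double : ∀ q G → (q + q) * G ≡ 2 * q * G
          double = solve-∀
          shape : 2 + suc t + t ≡ 2 * suc t + 1
          shape = identity t
            where
            identity : ∀ t → 2 + suc t + t ≡ 2 * suc t + 1
            identity = solve-∀
          exact : geo (n ∸ t) * gap k t ≡ gap n t * 1
          exact = begin-equality
            geo (n ∸ t) * gap k t           ≡⟨ cong (geo (n ∸ t) *_) (gap-shift t 1) ⟩
            geo (n ∸ t) * (r * geo 1 * q ^ t) ≡⟨ rearrange q r (geo (n ∸ t)) (q ^ t) ⟩
            r * geo (n ∸ t) * q ^ t * 1     ≡⟨ cong (_* 1) (gap-shift t (n ∸ t)) ⟨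
            gap (n ∸ t + t) t * 1           ≡⟨ cong (λ z → gap z t * 1) (ℕ.m∸n+n≡m (ℕ.≤-trans (ℕ.n≤1+n t) k≤n)) ⟩
            gap n t * 1                     ∎
            where
            rearrange : ∀ q r g p → g * (r * (1 + q * 0) * p) ≡ r * g * p * 1
            rearrange = solve-∀

-- Counting in a family of subspaces

infixr 7 _∩_

_∩_ : ∀ {N} → (Fin N → Bool) → (Fin N → Bool) → (Fin N → Bool)
(P ∩ Q) x = P x ∧ Q x

funToFin-cong : ∀ {m n} {f g : Fin m → Fin n} → f ≗ g → funToFin f ≡ funToFin g
funToFin-cong {zero}  _   = refl
funToFin-cong {suc m} f≗g = cong₂ combine (f≗g zero) (funToFin-cong (f≗g ∘ suc))

finToFun-injective : ∀ {m n} {i j : Fin (n ^ m)} → finToFun {n} {m} i ≗ finToFun j → i ≡ j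
finToFun-injective {m} {n} {i} {j} eq =
  trans (sym (funToFin-finToFin {m} {n} i)) (trans (funToFin-cong eq) (funToFin-finToFin {m} {n} j))

-- Coding subsets by a finite type lets k-spaces be counted with `card` and covers be searched for
-- with `any?`.
encode : ∀ {N} → (Fin N → Bool) → Fin (2 ^ N)
encode P = funToFin (Inverse.from 2↔Bool ∘ P)

decode : ∀ {N} → Fin (2 ^ N) → (Fin N → Bool)
decode i = Inverse.to 2↔Bool ∘ finToFun i

decode-encode : ∀ {N} (P : Fin N → Bool) → decode (encode P) ≗ P
decode-encode P x = trans (cong (Inverse.to 2↔Bool) (finToFun-funToFin (Inverse.from 2↔Bool ∘ P) x))
                          (Inverse.strictlyInverseˡ 2↔Bool (P x))

decode-injective : ∀ {N} {i j : Fin (2 ^ N)} → decode {N} i ≗ decode j → i ≡ j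
decode-injective e = finToFun-injective λ x → trans (sym (Inverse.strictlyInverseʳ 2↔Bool _))
  (trans (cong (Inverse.from 2↔Bool) (e x)) (Inverse.strictlyInverseʳ 2↔Bool _))

-- The counting knows a vector space only through these properties of its subspaces, given as sets
-- of vectors. Dimensions are read off from cardinalities, and `adjoin` is the span of a subspace
-- and one more vector.
record Geometry (r n N : ℕ) : Set₁ where
  open Powers r using (q)
  field
    card-points : N ≡ q ^ n
    IsSub       : (Fin N → Bool) → Set
    IsSub?      : ∀ P → Dec (IsSub P)
    IsSub-resp  : ∀ {P Q} → P ≗ Q → IsSub P → IsSub Q
    IsSub-∩     : ∀ {P Q} → IsSub P → IsSub Q → IsSub (P ∩ Q)
    dimension   : ∀ {P} → IsSub P → ∃ λ d → card P ≡ q ^ d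
    origin      : ∃ λ P → IsSub P × card P ≡ 1 × (∀ {Q} → IsSub Q → P ⊑ Q)
    adjoin      : ∀ {P} x → IsSub P → P x ≡ false →
                  ∃ λ P′ → IsSub P′ × card P′ ≡ q * card P × P ⊑ P′ × P′ x ≡ true ×
                           (∀ {Q} → IsSub Q → P ⊑ Q → Q x ≡ true → P′ ⊑ Q)

-- Double counting of pairs of an index `j` in `A` and a vector of `T` outside `W` lying in `f j`:
-- of the at least `m` vectors common to `T` and `f j`, at most `card (T ∩ W)` lie in `W`. It is
-- applied with `T` the whole space, a member of the family, and a space met by all members in `A`.
count-outside : ∀ {M N m X} (f : Fin M → Fin N → Bool) (A : Fin M → Bool) (T W : Fin N → Bool) →
  (∀ j → A j ≡ true → m ≤ card (T ∩ f j)) →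
  (∀ x → T x ≡ true → W x ≡ false → card (λ j → A j ∧ f j x) ≤ X) →
  card A * (m ∸ card (T ∩ W)) ≤ (card T ∸ card (T ∩ W)) * X
count-outside {m = m} {X} f A T W large small = begin
  card A * (m ∸ card (T ∩ W))                 ≤⟨ double-count A (λ x → T x ∧ not (W x)) f lower upper ⟩
  card (λ x → T x ∧ not (W x)) * X            ≡⟨ cong (_* X) (ℕ.m+n∸m≡n (card (T ∩ W)) _) ⟨
  (card (T ∩ W) + card (λ x → T x ∧ not (W x)) ∸ card (T ∩ W)) * X
                                              ≡⟨ cong (λ z → (z ∸ card (T ∩ W)) * X) (card-split T W) ⟨
  (card T ∸ card (T ∩ W)) * X                 ∎
  where
  open ℕ.≤-Reasoning
  lower : ∀ j → A j ≡ true → m ∸ card (T ∩ W) ≤ card (λ x → (T x ∧ not (W x)) ∧ f j x)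
  lower j Aj = ℕ.m≤n+o⇒m∸n≤o _ _ (begin
    m                                                           ≤⟨ large j Aj ⟩
    card (T ∩ f j)                                              ≡⟨ card-split (T ∩ f j) W ⟩
    card ((T ∩ f j) ∩ W) + card (λ x → (T ∩ f j) x ∧ not (W x)) ≤⟨ ℕ.+-mono-≤
      (card-mono ((T ∩ f j) ∩ W) (T ∩ W) inside) (card-mono (λ x → (T ∩ f j) x ∧ not (W x))
        (λ x → (T x ∧ not (W x)) ∧ f j x) outside) ⟩
    card (T ∩ W) + card (λ x → (T x ∧ not (W x)) ∧ f j x)       ∎)
    where
    inside : ((T ∩ f j) ∩ W) ⊑ (T ∩ W)
    inside x e = let (tf , w) = ∧-true ((T ∩ f j) x) e in ∧-intro (proj₁ (∧-true (T x) tf)) w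
    outside : (λ x → (T ∩ f j) x ∧ not (W x)) ⊑ (λ x → (T x ∧ not (W x)) ∧ f j x)
    outside x e = let (tf , w) = ∧-true ((T ∩ f j) x) e in ∧-intro (∧-intro (proj₁ (∧-true (T x) tf)) w)
      (proj₂ (∧-true (T x) tf))
  upper : ∀ x → T x ∧ not (W x) ≡ true → card (λ j → A j ∧ f j x) ≤ X
  upper x e = let (tx , wx) = ∧-true (T x) e in small x tx (not-true (W x) wx)

module Incidence {r n N} (1≤r : 1 ≤ r) (𝔾 : Geometry r n N) (k : ℕ) (k≤n : k ≤ n) where

  open Powers r
  open Counts 1≤r n k k≤n
  open Geometry 𝔾

  all : Fin N → Bool
  all _ = true

  card-all : card all ≡ q ^ n
  card-all = trans (card-true N) card-points

  subspace-of-dim : ∀ s → s ≤ n → ∃ λ W → IsSub W × card W ≡ q ^ s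
  subspace-of-dim zero    _   = let (O , sub , one , _) = origin in O , sub , one
  subspace-of-dim (suc s) s<n with subspace-of-dim s (ℕ.<⇒≤ s<n)
  ... | W , sub , cW with all? (λ x → W x ≟ᵇ true)
  ...   | yes full = contradiction (ℕ.^-monoʳ-< q (1<q 1≤r) s<n)
            (ℕ.≤⇒≯ (subst₂ _≤_ card-all cW (card-mono all W λ x _ → full x)))
  ...   | no ¬full = let (x , ¬Wx) = ¬∀⟶∃¬ N _ (λ x → W x ≟ᵇ true) ¬full
                         (W′ , sub′ , cW′ , _) = adjoin x sub (¬-not ¬Wx)
                     in W′ , sub′ , trans cW′ (cong (q *_) cW)

  isSuper : (Fin N → Bool) → Fin (2 ^ N) → Bool
  isSuper W j = does (IsSub? (decode j) ×-dec (card (decode {N} j) ℕ.≟ q ^ k) ×-dec (W ⊑? decode j))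

  isSuper-true : ∀ {W j} → IsSub (decode j) → card (decode {N} j) ≡ q ^ k → W ⊑ decode j → isSuper W j ≡ true
  isSuper-true {W} {j} s c i = dec-true (IsSub? (decode j) ×-dec (card (decode {N} j) ℕ.≟ q ^ k) ×-dec (W ⊑? decode j))
    (s , c , i)

  isSuper⇒ : ∀ {W j} → isSuper W j ≡ true → IsSub (decode j) × card (decode {N} j) ≡ q ^ k × W ⊑ decode j
  isSuper⇒ {W} {j} = does-true (IsSub? (decode j) ×-dec (card (decode {N} j) ℕ.≟ q ^ k) ×-dec (W ⊑? decode j))

  -- Count pairs of a vector outside `W` and a k-space through both. The vector enlarges `W` to an
  -- (s + 1)-space, to which induction applies; each k-space through `W` has at most q ^ k - q ^ s
  -- such vectors.
  supers-≤-card : ∀ s d → s + d ≡ k → ∀ W → IsSub W → card W ≡ q ^ s → supers s d ≤ card (isSuper W)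
  supers-≤-card s zero s≡k W sub cW = card≥1 (isSuper W) (encode W)
    (isSuper-true (IsSub-resp (sym ∘ decode-encode W) sub)
      (trans (card-cong (decode-encode W)) (trans cW (cong (q ^_) (trans (sym (ℕ.+-identityʳ s)) s≡k))))
      (λ x Wx → trans (decode-encode W x) Wx))
  supers-≤-card s (suc d) refl W sub cW = ℕ.*-cancelʳ-≤ _ _ (gap k s) {{>-nonZero (gap>0 1≤r s<k)}} (begin
    supers s (suc d) * gap k s                            ≤⟨ supers-upper s d s<k ⟩
    gap n s * supers (suc s) d                            ≡⟨ cong₂ (λ a b → (a ∸ b) * supers (suc s) d) card-all cW ⟨
    (card all ∸ card W) * supers (suc s) d                ≡⟨ cong (λ z → (z ∸ card W) * supers (suc s) d)
      (card-split all W) ⟩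
    (card W + card (not ∘ W) ∸ card W) * supers (suc s) d ≡⟨ cong (_* supers (suc s) d) (ℕ.m+n∸m≡n (card W) _) ⟩
    card (not ∘ W) * supers (suc s) d                     ≤⟨ double-count (not ∘ W) (isSuper W)
      (λ x j → decode j x) lower upper ⟩
    card (isSuper W) * gap k s                            ∎)
    where
    open ℕ.≤-Reasoning
    s<k : s < s + suc d
    s<k = ℕ.m<m+n s (s≤s z≤n)
    lower : ∀ x → not (W x) ≡ true → supers (suc s) d ≤ card (λ j → isSuper W j ∧ decode j x)
    lower x ¬Wx with adjoin x sub (not-true (W x) ¬Wx)
    ... | W′ , sub′ , cW′ , W⊑W′ , W′x , _ = ℕ.≤-trans
      (supers-≤-card (suc s) d (sym (ℕ.+-suc s d)) W′ sub′ (trans cW′ (cong (q *_) cW)))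
      (card-mono (isSuper W′) (λ j → isSuper W j ∧ decode j x) λ j e → let (a , b , c) = isSuper⇒ {W′} {j} e in
        ∧-intro (isSuper-true {W} {j} a b (λ y → c y ∘ W⊑W′ y)) (c x W′x))
    upper : ∀ j → isSuper W j ≡ true → card (λ x → not (W x) ∧ decode j x) ≤ gap k s
    upper j e with isSuper⇒ {W} {j} e
    ... | _ , cF , W⊑F = ℕ.m+n≤o⇒m≤o∸n _ (begin
      card (λ x → not (W x) ∧ F x) + q ^ s            ≡⟨ ℕ.+-comm _ (q ^ s) ⟩
      q ^ s + card (λ x → not (W x) ∧ F x)            ≡⟨ cong (_+ card (λ x → not (W x) ∧ F x)) cW ⟨
      card W + card (λ x → not (W x) ∧ F x)           ≤⟨ ℕ.+-mono-≤ (card-mono W (F ∩ W) λ x w → ∧-intro (W⊑F x w) w)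
                                                           (card-mono (λ x → not (W x) ∧ F x)
                                                             (λ x → F x ∧ not (W x)) λ x e →
                                                               let (a , b) = ∧-true (not (W x)) e in ∧-intro b a) ⟩
      card (F ∩ W) + card (λ x → F x ∧ not (W x))     ≡⟨ card-split F W ⟨
      card F                                          ≡⟨ cF ⟩
      q ^ k                                           ∎)
      where
      F : Fin N → Bool
      F = decode j

  module SubspaceFamily {M} (f : Fin M → Fin N → Bool)
    (f-sub : ∀ j → IsSub (f j)) (f-card : ∀ j → card (f j) ≡ q ^ k)
    (f-injective : ∀ i j → f i ≗ f j → i ≡ j) where

    through : (Fin N → Bool) → Fin M → Bool
    through W j = does (W ⊑? f j)

    degree : (Fin N → Bool) → ℕ
    degree W = card (through W)

    through⇒ : ∀ {W j} → through W j ≡ true → W ⊑ f j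
    through⇒ {W} {j} = does-true (W ⊑? f j)

    through-adjoin : ∀ {W W′ : Fin N → Bool} {x} →
      (∀ {Q} → IsSub Q → W ⊑ Q → Q x ≡ true → W′ ⊑ Q) →
      ∀ j → through W j ≡ true → f j x ≡ true → through W′ j ≡ true
    through-adjoin {W} {W′} least j e fx = dec-true (W′ ⊑? f j) (least (f-sub j) (through⇒ {W} {j} e) fx)

    -- The same count restricted to the members, with the inequalities reversed. At s = k a member
    -- through `W` equals `W`, and injectivity of `f` leaves at most one.
    degree-≤-supers : ∀ s d → s + d ≡ k → ∀ W → IsSub W → card W ≡ q ^ s → degree W ≤ supers s d
    degree-≤-supers s zero s≡k W sub cW = card≤1 (through W) λ i j ei ej → f-injective i j λ x →
      trans (sym (same i ei x)) (same j ej x)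
      where
      same : ∀ j → through W j ≡ true → W ≗ f j
      same j e = ⊑-antisym {P = W} (through⇒ {W} {j} e) (⊑-reverse W (f j) (through⇒ {W} {j} e)
        (ℕ.≤-reflexive (trans (f-card j) (trans (cong (q ^_) (sym (trans (sym (ℕ.+-identityʳ s)) s≡k))) (sym cW)))))
    degree-≤-supers s (suc d) refl W sub cW = supers-lower s d (ℕ.m<m+n s (s≤s z≤n))
      (subst₂ (λ a b → degree W * (q ^ k ∸ a) ≤ (b ∸ a) * supers (suc s) d) cW card-all
        (count-outside f (through W) all W (λ j _ → ℕ.≤-reflexive (sym (f-card j))) small))
      where
      small : ∀ x → all x ≡ true → W x ≡ false → card (λ j → through W j ∧ f j x) ≤ supers (suc s) d
      small x _ Wx with adjoin x sub Wx
      ... | W′ , sub′ , cW′ , _ , _ , least = ℕ.≤-trans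
        (card-mono (λ j → through W j ∧ f j x) (through W′) λ j e → let (a , b) = ∧-true (through W j) e in
          through-adjoin {W} {W′} least j a b)
        (degree-≤-supers (suc s) d (sym (ℕ.+-suc s d)) W′ sub′ (trans cW′ (cong (q *_) cW)))

    -- Covers of an almost t-intersecting family

    module Covers (t : ℕ) (t<k : suc t ≤ k)
      (almost : ∀ i j₁ j₂ → card (f i ∩ f j₁) < q ^ t → card (f i ∩ f j₂) < q ^ t → j₁ ≡ j₂) where

      -- `a` is the largest value of (q ^ k - q ^ e) / (q ^ t - q ^ e) for e < t, attained at e = t
      -- - 1; the extra one in `b` pays for the exceptional member.
      a b : ℕ
      a = geo (suc (k ∸ t))
      b = suc a

      open Contradiction t b

      Cover : ℕ → Set
      Cover s = ∃ λ W → IsSub W × card W ≡ q ^ s × ∀ j → q ^ t ≤ card (f j ∩ W)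

      cover? : ∀ s → Dec (Cover s)
      cover? s = map′ (λ (i , c) → decode i , c)
        (λ (W , sub , cW , cov) → encode W , IsSub-resp (sym ∘ decode-encode W) sub , trans
          (card-cong (decode-encode W)) cW ,
          λ j → ℕ.≤-trans (cov j) (ℕ.≤-reflexive (card-cong λ x → cong (f j x ∧_) (sym (decode-encode W x)))))
        (any? λ i → IsSub? (decode i) ×-dec (card (decode {N} i) ℕ.≟ q ^ s) ×-dec all? λ j → q ^ t ℕ.≤? card
          (f j ∩ decode i))

      meets : Fin M → Fin M → Bool
      meets i j = does (q ^ t ℕ.≤? card (f i ∩ f j))

      exceptions≤1 : ∀ i → card (not ∘ meets i) ≤ 1
      exceptions≤1 i = card≤1 (not ∘ meets i) λ j₁ j₂ e₁ e₂ → almost i j₁ j₂ (bad j₁ e₁) (bad j₂ e₂)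
        where
        bad : ∀ j → not (meets i j) ≡ true → card (f i ∩ f j) < q ^ t
        bad j e = ℕ.≰⇒> λ le → true≢false (dec-true (q ^ t ℕ.≤? card (f i ∩ f j)) le) (not-true (meets i j) e)

      all-but-one : ∀ i (A : Fin M → Bool) → card A ≤ card (λ j → A j ∧ meets i j) + 1
      all-but-one i A = begin
        card A                                                                  ≡⟨ card-split A (meets i) ⟩
        card (λ j → A j ∧ meets i j) + card (λ j → A j ∧ not (meets i j))       ≤⟨ ℕ.+-monoʳ-≤
          (card (λ j → A j ∧ meets i j))
                                                                                     (ℕ.≤-trans (card-mono
                                                                                       (λ j → A j ∧ not (meets i j))
                                                                                         (not ∘ meets i) λ j e → proj₂
                                                                                           (∧-true (A j) e)) (exceptions≤1 i)) ⟩
        card (λ j → A j ∧ meets i j) + 1                                        ∎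
        where open ℕ.≤-Reasoning

      -- Equality holds at u = 0; each step multiplies by `q` and adds 1 on the left but
      -- `geo (suc c)` on the right.
      geo-submult : ∀ c u → geo (c + suc u) ≤ geo (suc c) * geo (suc u)
      geo-submult c zero    = ℕ.≤-reflexive (trans (cong geo (ℕ.+-comm c 1))
        (sym (trans (cong (geo (suc c) *_) (cong suc (ℕ.*-zeroʳ q))) (ℕ.*-identityʳ _))))
      geo-submult c (suc u) = begin
        geo (c + suc (suc u))                       ≡⟨ cong geo (ℕ.+-suc c (suc u)) ⟩
        1 + q * geo (c + suc u)                     ≤⟨ ℕ.+-mono-≤ (s≤s z≤n) (ℕ.*-monoʳ-≤ q (geo-submult c u)) ⟩
        geo (suc c) + q * (geo (suc c) * geo (suc u)) ≡⟨ factor (geo (suc c)) q (geo (suc u)) ⟩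
        geo (suc c) * (1 + q * geo (suc u))         ∎
        where
        open ℕ.≤-Reasoning
        factor : ∀ g q h → g + q * (g * h) ≡ g * (1 + q * h)
        factor = solve-∀

      -- Division by (q - 1) * q ^ e leaves geo (k - e) ≤ a * geo (t - e), which is `geo-submult`
      -- with c = k - t and suc u = t - e.
      gap-ratio : ∀ e → e < t → gap k e ≤ a * gap t e
      gap-ratio e e<t = begin
        gap k e                                     ≡⟨ cong (λ z → gap z e) k≡ ⟩
        gap ((k ∸ t + suc u) + e) e                 ≡⟨ gap-shift e (k ∸ t + suc u) ⟩
        r * geo (k ∸ t + suc u) * q ^ e             ≤⟨ ℕ.*-monoˡ-≤ (q ^ e) (ℕ.*-monoʳ-≤ r (geo-submult (k ∸ t) u)) ⟩
        r * (a * geo (suc u)) * q ^ e               ≡⟨ rearrange r a (geo (suc u)) (q ^ e) ⟩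
        a * (r * geo (suc u) * q ^ e)               ≡⟨ cong (a *_) (gap-shift e (suc u)) ⟨
        a * gap (suc u + e) e                       ≡⟨ cong (λ z → a * gap z e) t≡ ⟩
        a * gap t e                                 ∎
        where
        open ℕ.≤-Reasoning
        u : ℕ
        u = t ∸ suc e
        t≡ : suc u + e ≡ t
        t≡ = trans (sym (ℕ.+-suc u e)) (ℕ.m∸n+n≡m e<t)
        k≡ : k ≡ (k ∸ t + suc u) + e
        k≡ = sym (trans (ℕ.+-assoc (k ∸ t) (suc u) e) (trans (cong (k ∸ t +_) t≡) (ℕ.m∸n+n≡m (ℕ.<⇒≤ t<k))))
        rearrange : ∀ r a g p → r * (a * g) * p ≡ a * (r * g * p)
        rearrange = solve-∀

      -- Let q ^ e be the size of `f i ∩ W`, so e < t. With at most one exception, every member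
      -- through `W` contains at least q ^ t - q ^ e of the q ^ k - q ^ e vectors of `f i` outside
      -- `W`, and each such vector lies in at most `X` of these members. The exception is absorbed
      -- by 1 ≤ X.
      branch : ∀ s W i X → IsSub W → card W ≡ q ^ s → card (f i ∩ W) < q ^ t → 1 ≤ X →
        (∀ W′ → IsSub W′ → card W′ ≡ q ^ suc s → degree W′ ≤ X) → degree W ≤ b * X
      branch s W i X sub cW small 1≤X bound with dimension (IsSub-∩ (f-sub i) sub)
      ... | e , ce = begin
        degree W                                      ≤⟨ all-but-one i (through W) ⟩
        card A + 1                                    ≤⟨ ℕ.+-mono-≤
          (ℕ.*-cancelʳ-≤ (card A) (a * X) (gap t e) {{>-nonZero (gap>0 1≤r e<t)}} counted) 1≤X ⟩
        a * X + X                                     ≡⟨ ℕ.+-comm (a * X) X ⟩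
        b * X                                         ∎
        where
        open ℕ.≤-Reasoning
        A : Fin M → Bool
        A j = through W j ∧ meets i j
        e<t : e < t
        e<t = ℕ.≰⇒> λ t≤e → ℕ.<⇒≱ small (subst (q ^ t ≤_) (sym ce) (ℕ.^-monoʳ-≤ q t≤e))
        swap : ∀ a g X → a * g * X ≡ a * X * g
        swap = solve-∀
        extend : ∀ x → f i x ≡ true → W x ≡ false → card (λ j → A j ∧ f j x) ≤ X
        extend x _ Wx with adjoin x sub Wx
        ... | W′ , sub′ , cW′ , _ , _ , least = ℕ.≤-trans
          (card-mono (λ j → A j ∧ f j x) (through W′) λ j e → let (c , d) = ∧-true (A j) e in through-adjoin
            {W} {W′} least j (proj₁ (∧-true (through W j) c)) d)
          (bound W′ sub′ (trans cW′ (cong (q *_) cW)))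
        counted : card A * gap t e ≤ a * X * gap t e
        counted = begin
          card A * gap t e                            ≤⟨ subst₂ (λ y z → card A * (q ^ t ∸ y) ≤ (z ∸ y) * X) ce
            (f-card i)
                                                          (count-outside f A (f i) W
                                                            (λ j Aj → does-true (q ^ t ℕ.≤? card (f i ∩ f j))
                                                              (proj₂ (∧-true (through W j) Aj))) extend) ⟩
          gap k e * X                                 ≤⟨ ℕ.*-monoˡ-≤ X (gap-ratio e e<t) ⟩
          a * gap t e * X                             ≡⟨ swap a (gap t e) X ⟩
          a * X * gap t e                             ∎

      b^≥1 : ∀ j → 1 ≤ b ^ j
      b^≥1 j = ℕ.m^n>0 b j

      -- No space of dimension from `t` to τ - 1 is a cover, so `branch` applies τ - s times, each
      -- time at the cost of a factor `b`; at dimension τ the count of all k-spaces takes over.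
      descent : ∀ {τ d} → τ + d ≡ k → (∀ s → t ≤ s → s < τ → ¬ Cover s) →
        ∀ j s → t ≤ s → s + j ≡ τ → ∀ W → IsSub W → card W ≡ q ^ s → degree W ≤ b ^ j * supers τ d
      descent {τ} {d} τ+d none zero s t≤s refl W sub cW = ℕ.≤-trans
        (degree-≤-supers s d (trans (cong (_+ d) (sym (ℕ.+-identityʳ s))) τ+d) W sub cW)
        (ℕ.≤-reflexive (trans (cong (λ z → supers z d) (sym (ℕ.+-identityʳ s))) (sym (ℕ.*-identityˡ _))))
      descent {τ} {d} τ+d none (suc j) s t≤s s+j W sub cW
        with all? (λ i → q ^ t ℕ.≤? card (f i ∩ W))
      ... | yes cover = contradiction (W , sub , cW , cover) (none s t≤s (subst (s <_) s+j (ℕ.m<m+n s (s≤s z≤n))))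
      ... | no ¬cover with ¬∀⟶∃¬ M _ (λ i → q ^ t ℕ.≤? card (f i ∩ W)) ¬cover
      ...   | i , ¬large = ℕ.≤-trans
        (branch s W i (b ^ j * supers τ d) sub cW (ℕ.≰⇒> ¬large) (ℕ.*-mono-≤ (b^≥1 j) (supers≥1 τ d τ+d))
          (descent τ+d none j (suc s) (ℕ.m≤n⇒m≤1+n t≤s) (trans (sym (ℕ.+-suc s j)) s+j)))
        (ℕ.≤-reflexive (sym (ℕ.*-assoc b (b ^ j) (supers τ d))))

      -- The sum over t-subspaces of `T`, done one vector at a time: each member in `A` through `W`
      -- contains at least q ^ t - q ^ s of the q ^ τ - q ^ s vectors of `T` outside `W`. From the
      -- zero space, s = 0, it bounds `card A` by [τ, t] * X.
      cover-count : ∀ {τ X} T (A : Fin M → Bool) → card T ≡ q ^ τ → t ≤ τ →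
        (∀ j → A j ≡ true → q ^ t ≤ card (T ∩ f j)) →
        (∀ W → IsSub W → card W ≡ q ^ t → degree W ≤ X) →
        IsSub T → ∀ d s → s + d ≡ t → ∀ W → IsSub W → card W ≡ q ^ s → W ⊑ T →
        card (λ j → A j ∧ through W j) * falling t s d ≤ falling τ s d * X
      cover-count {τ} {X} T A cT t≤τ meet bound subT zero s s≡t W sub cW W⊑T = begin
        card (λ j → A j ∧ through W j) * 1    ≡⟨ ℕ.*-identityʳ _ ⟩
        card (λ j → A j ∧ through W j)        ≤⟨ card-mono (λ j → A j ∧ through W j) (through W)
          (λ j e → proj₂ (∧-true (A j) e)) ⟩
        degree W                              ≤⟨ bound W sub (trans cW
          (cong (q ^_) (trans (sym (ℕ.+-identityʳ s)) s≡t))) ⟩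
        X                                     ≡⟨ ℕ.*-identityˡ X ⟨
        1 * X                                 ∎
        where open ℕ.≤-Reasoning
      cover-count {τ} {X} T A cT t≤τ meet bound subT (suc d) s refl W sub cW W⊑T = begin
        card A′ * (gap t s * c)               ≡⟨ ℕ.*-assoc (card A′) (gap t s) c ⟨
        card A′ * gap t s * c                 ≤⟨ ℕ.*-monoˡ-≤ c
          (subst₂ (λ y z → card A′ * (q ^ t ∸ y) ≤ (z ∸ y) * Y) T∩W cT
                                                   (count-outside f A′ T W
                                                     (λ j e → meet j (proj₁ (∧-true (A j) e))) small)) ⟩
        gap τ s * Y * c                       ≡⟨ ℕ.*-assoc (gap τ s) Y c ⟩
        gap τ s * (Y * c)                     ≤⟨ ℕ.*-monoʳ-≤ (gap τ s) (m/n*n≤m (falling τ (suc s) d * X) c) ⟩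
        gap τ s * (falling τ (suc s) d * X)   ≡⟨ ℕ.*-assoc (gap τ s) (falling τ (suc s) d) X ⟨
        gap τ s * falling τ (suc s) d * X     ∎
        where
        open ℕ.≤-Reasoning
        A′ : Fin M → Bool
        A′ j = A j ∧ through W j
        c : ℕ
        c = falling (s + suc d) (suc s) d
        instance
          c-nonZero : NonZero c
          c-nonZero = >-nonZero (falling>0 1≤r (s + suc d) (suc s) d (ℕ.≤-reflexive (sym (ℕ.+-suc s d))))
        -- The inductive inequality for (s + 1)-spaces, solved for the number of members. Rounding
        -- down is safe because that number is an integer.
        Y : ℕ
        Y = falling τ (suc s) d * X / c
        T∩W : card (T ∩ W) ≡ q ^ s
        T∩W = trans (card-cong (⊑-antisym {P = T ∩ W} {W} (λ x e → proj₂ (∧-true (T x) e))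
          (λ x e → ∧-intro (W⊑T x e) e))) cW
        small : ∀ x → T x ≡ true → W x ≡ false → card (λ j → A′ j ∧ f j x) ≤ Y
        small x Tx Wx with adjoin x sub Wx
        ... | W′ , sub′ , cW′ , _ , _ , least = ℕ.≤-trans
          (card-mono (λ j → A′ j ∧ f j x) (λ j → A j ∧ through W′ j) λ j e →
            let (u , fx) = ∧-true (A′ j) e ; (Aj , th) = ∧-true (A j) u in ∧-intro Aj
              (through-adjoin {W} {W′} least j th fx))
          (*≤⇒≤/ c (cover-count T A cT t≤τ meet bound subT d (suc s) (sym (ℕ.+-suc s d)) W′ sub′
            (trans cW′ (cong (q *_) cW)) (least subT W⊑T Tx)))

      -- The two forms in which the size of `n` is used: the first leads to `wide`, the second, for
      -- k = t + 1, to `narrow`.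
      Admissible : Set
      Admissible = (q ^ suc t * b ≤ r * Q) ⊎ (suc t ≡ k × 2 * k + 1 ≤ n)

      -- The star bound on `M` is played against `cover-count` fed with `descent`. Counting only the
      -- members in `A`, all but at most one, lets either a cover or a member of the family take the
      -- role of `T`.
      no-cover : Admissible → supers t (k ∸ t) ≤ M → ∀ j d → suc t + j + d ≡ k →
        (∀ s → t ≤ s → s < suc t + j → ¬ Cover s) →
        ∀ T (A : Fin M → Bool) → IsSub T → card T ≡ q ^ (suc t + j) → (∀ j → A j ≡ true → q ^ t ≤ card (T ∩ f j)) →
        M ≤ 1 + card A → ⊥
      no-cover adm M≥ j d eq none T A subT cT meet M≤ = finish adm eq counted
        where
        below : ∀ W → IsSub W → card W ≡ q ^ t → degree W ≤ b ^ suc j * supers (suc t + j) d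
        below = descent eq none (suc j) t ℕ.≤-refl (ℕ.+-suc t j)
        counted : card A * falling t 0 t ≤ falling (suc t + j) 0 t * (b ^ suc j * supers (suc t + j) d)
        -- The zero space starts `cover-count` at s = 0, and every member contains it.
        counted with origin
        ... | O , subO , cO , O⊑ = ℕ.≤-trans
          (ℕ.*-monoˡ-≤ (falling t 0 t) (card-mono A (λ j → A j ∧ through O j) λ i e → ∧-intro e
            (dec-true (O ⊑? f i) (O⊑ (f-sub i)))))
          (cover-count T A cT (ℕ.≤-trans (ℕ.n≤1+n t) (ℕ.m≤m+n (suc t) j)) meet below subT t 0 refl O subO cO (O⊑ subT))
        a≥2 : q < b
        a≥2 with k ∸ t in eq′
        ... | zero  = contradiction (ℕ.m<n⇒0<n∸m t<k) (subst (λ z → ¬ (0 < z)) (sym eq′) λ ())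
        ... | suc v = s≤s (ℕ.≤-trans (ℕ.≤-trans (ℕ.≤-reflexive (sym (ℕ.*-identityʳ q))) (ℕ.*-monoʳ-≤ q (s≤s z≤n)))
            (ℕ.n≤1+n _))
        k∸t : k ∸ t ≡ suc j + d
        k∸t = trans (cong (_∸ t) (sym (trans (cong (_+ d) (ℕ.+-suc t j)) eq)))
          (trans (cong (_∸ t) (ℕ.+-assoc t (suc j) d)) (ℕ.m+n∸m≡n t (suc j + d)))
        finish : Admissible → suc t + j + d ≡ k →
          card A * falling t 0 t ≤ falling (suc t + j) 0 t * (b ^ suc j * supers (suc t + j) d) → ⊥
        finish (inj₁ hyp) eq c = wide hyp a≥2 j d eq c (subst (λ z → supers t z ≤ 1 + card A) k∸t (ℕ.≤-trans M≥ M≤))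
        finish (inj₂ (t+1≡k , 2k<n)) eq c = narrow {card A} t+1≡k 2k<n (cong (λ z → suc (geo (suc z))) k-t)
          (count′ j d j≡0 d≡0 c)
            (ℕ.≤-trans (ℕ.≤-reflexive (cong (supers t) (sym k-t))) (ℕ.≤-trans M≥ M≤))
          where
          k-t : k ∸ t ≡ 1
          k-t = trans (cong (_∸ t) (sym t+1≡k)) (ℕ.m+n∸n≡m 1 t)
          -- Here t + 1 = k forces j = d = 0, where `supers` is 1 and `b` occurs once.
          j+d≡0 : j + d ≡ 0
          j+d≡0 = ℕ.suc-injective (trans (sym k∸t) k-t)
          j≡0 : j ≡ 0
          j≡0 = ℕ.m+n≡0⇒m≡0 j j+d≡0
          d≡0 : d ≡ 0
          d≡0 = ℕ.m+n≡0⇒n≡0 j j+d≡0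
          count′ : ∀ j d → j ≡ 0 → d ≡ 0 → card A * falling t 0 t ≤ falling (suc t + j) 0 t *
            (b ^ suc j * supers (suc t + j) d) →
            card A * falling t 0 t ≤ falling (suc t) 0 t * (b * 1)
          count′ j d refl refl = subst₂ (λ x y → card A * falling t 0 t ≤ falling (suc x) 0 t * y) (ℕ.+-identityʳ t)
            (ℕ.*-identityʳ (b * 1))

      -- A t-space sharing q ^ t vectors with `f j` lies in `f j`, so a t-dimensional cover is the
      -- centre. If there is none, strong induction on the dimension excludes every cover below `k`,
      -- and then a member leads to the contradiction.
      star-centre : Admissible → supers t (k ∸ t) ≤ M → ∃ λ E → IsSub E × card E ≡ q ^ t × ∀ j → E ⊑ f j
      star-centre adm M≥ with cover? t
      ... | yes (E , sub , cE , cover) = E , sub , cE , λ j x Ex →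
        proj₁ (∧-true (f j x) (⊑-reverse (f j ∩ E) E (λ y e → proj₂ (∧-true (f j y) e))
          (subst (_≤ card (f j ∩ E)) (sym cE) (cover j)) x Ex))
      -- `T` is the member `f i`, of dimension `k`; `meets i` leaves out at most one member.
      ... | no ¬t = ⊥-elim (no-cover adm M≥ (k ∸ suc t) 0 (trans (ℕ.+-identityʳ _) k≡)
          (λ s t≤s s<k → none s t≤s (subst (s <_) k≡ s<k))
              (f i) (meets i) (f-sub i) (trans (f-card i) (cong (q ^_) (sym k≡)))
              (λ j → does-true (q ^ t ℕ.≤? card (f i ∩ f j)))
              (subst₂ _≤_ (card-true M) (ℕ.+-comm _ 1) (all-but-one i (λ _ → true))))
        where
        k≡ : suc t + (k ∸ suc t) ≡ k
        k≡ = ℕ.m+[n∸m]≡n t<k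
        element : ∀ {m} → 1 ≤ m → Fin m
        element (s≤s _) = zero
        i : Fin M
        i = element (ℕ.≤-trans (supers≥1 t (k ∸ t) (ℕ.m+[n∸m]≡n (ℕ.<⇒≤ t<k))) M≥)
        none : ∀ s → t ≤ s → s < k → ¬ Cover s
        none = <-rec _ step
          where
          step : ∀ τ → (∀ {s} → s < τ → t ≤ s → s < k → ¬ Cover s) → t ≤ τ → τ < k → ¬ Cover τ
          step τ rec t≤τ τ<k cov with ℕ.m≤n⇒m<n∨m≡n t≤τ
          ... | inj₂ refl = ¬t cov
          ... | inj₁ t<τ with cov
          -- `T` is a cover of least dimension, so `A` consists of all members.
          ...   | T , subT , cT , cover = no-cover adm M≥ (τ ∸ suc t) (k ∸ τ)
                    (trans (cong (_+ (k ∸ τ)) τ≡) (ℕ.m+[n∸m]≡n (ℕ.<⇒≤ τ<k)))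
                    (λ s t≤s s<τ → rec (subst (s <_) τ≡ s<τ) t≤s (ℕ.<-trans (subst (s <_) τ≡ s<τ) τ<k))
                    T (λ _ → true) subT (trans cT (cong (q ^_) (sym τ≡)))
                    (λ j _ → ℕ.≤-trans (cover j) (card-mono (f j ∩ T) (T ∩ f j) λ x e →
                      let (u , v) = ∧-true (f j x) e in ∧-intro v u))
                    (ℕ.≤-trans (ℕ.≤-reflexive (sym (card-true M))) (ℕ.n≤1+n _))
            where
            τ≡ : suc t + (τ ∸ suc t) ≡ τ
            τ≡ = ℕ.m+[n∸m]≡n t<τ

-- Linear algebra over a finite field

module LinearAlgebra {r : ℕ} {c ℓ m ℓm : Level} (K : FiniteField (suc r) c ℓ)
  (V : Module (FiniteField.commutativeRing K) m ℓm) where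

  open FiniteField K hiding (zero; refl)
    renaming (Carrier to Scalar; _+_ to _+ᵏ_; _*_ to _*ᵏ_; sym to ≈-sym; trans to ≈-trans; reflexive to ≈-reflexive)
  open Module V
  open Subspaces K V
  open Powers r using (q)

  open Inverse enumeration using ()
    renaming (to to index; from to scalar; to-cong to index-cong; strictlyInverseˡ to index-scalar; strictlyInverseʳ to scalar-index)
  open RingProperties ring using (-1*x≈-x)
  open GroupProperties +-group using (x∙y⁻¹≈ε⇒x≈y)
  open Sum +ᴹ-commutativeMonoid using (sum-cong-≋) renaming (∑-distrib-+ to ∑ᴹ-distrib-+)

  1≤r : 1 ≤ r
  1≤r = two (index 0#) (index 1#) λ e → 0≉1 (≈-trans (≈-sym (scalar-index 0#))
    (≈-trans (≈-reflexive (cong scalar e)) (scalar-index 1#)))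
    where
    two : ∀ {r} (i j : Fin (suc r)) → ¬ i ≡ j → 1 ≤ r
    two {zero}  zero zero i≢j = contradiction refl i≢j
    two {suc _} _    _    _   = s≤s z≤n

  index-injective : ∀ {x y} → index x ≡ index y → x ≈ y
  index-injective {x} {y} e = ≈-trans (≈-sym (scalar-index x)) (≈-trans (≈-reflexive (cong scalar e)) (scalar-index y))

  linComb-cong : ∀ {d} {a a′ : Vector Scalar d} (b : Vector Carrierᴹ d) → (∀ i → a i ≈ a′ i) →
    linComb a b ≈ᴹ linComb a′ b
  linComb-cong b e = sum-cong-≋ (λ i → *ₗ-congʳ (e i))

  linComb-+ : ∀ {d} (a a′ : Vector Scalar d) (b : Vector Carrierᴹ d) → linComb
    (λ i → a i +ᵏ a′ i) b ≈ᴹ linComb a b +ᴹ linComb a′ b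
  linComb-+ a a′ b = ≈ᴹ-trans (sum-cong-≋ (λ i → *ₗ-distribʳ (b i) (a i) (a′ i)))
    (∑ᴹ-distrib-+ (λ i → a i *ₗ b i) (λ i → a′ i *ₗ b i))

  linComb-* : ∀ {d} s (a : Vector Scalar d) (b : Vector Carrierᴹ d) → linComb (λ i → s *ᵏ a i) b ≈ᴹ s *ₗ linComb a b
  linComb-* {zero}  s a b = ≈ᴹ-sym (*ₗ-zeroʳ s)
  linComb-* {suc d} s a b = ≈ᴹ-trans (+ᴹ-cong (*ₗ-assoc s (a zero) (b zero)) (linComb-* s (a ∘ suc) (b ∘ suc)))
                                     (≈ᴹ-sym (*ₗ-distribˡ s (a zero *ₗ b zero) (linComb (a ∘ suc) (b ∘ suc))))

  linComb-zero : ∀ {d} (b : Vector Carrierᴹ d) → linComb (λ _ → 0#) b ≈ᴹ 0ᴹ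
  linComb-zero {zero}  b = ≈ᴹ-refl
  linComb-zero {suc d} b = ≈ᴹ-trans (+ᴹ-cong (*ₗ-zeroˡ (b zero)) (linComb-zero (b ∘ suc))) (+ᴹ-identityˡ 0ᴹ)

  linComb-unit : ∀ {d} (b : Vector Carrierᴹ d) i → ∃ λ a → b i ≈ᴹ linComb a b
  linComb-unit b zero    = 1# ∷ᵛ (λ _ → 0#) ,
    ≈ᴹ-sym (≈ᴹ-trans (+ᴹ-cong (*ₗ-identityˡ (b zero)) (linComb-zero (b ∘ suc))) (+ᴹ-identityʳ (b zero)))
  linComb-unit b (suc i) = let (a , e) = linComb-unit (b ∘ suc) i in 0# ∷ᵛ a ,
    ≈ᴹ-trans e (≈ᴹ-sym (≈ᴹ-trans (+ᴹ-congʳ (*ₗ-zeroˡ (b zero))) (+ᴹ-identityˡ _)))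

  linComb-member : ∀ {p d} (W : Subspace p) (a : Vector Scalar d) {b : Vector Carrierᴹ d} → (∀ i → carrier W (b i)) →
    carrier W (linComb a b)
  linComb-member {d = zero}  W a mem = 0-closed W
  linComb-member {d = suc d} W a mem = +-closed W (*-closed W (a zero) (mem zero))
    (linComb-member W (a ∘ suc) (mem ∘ suc))

  *ₗ-cancel : ∀ s x → s *ₗ x +ᴹ (- s) *ₗ x ≈ᴹ 0ᴹ
  *ₗ-cancel s x = ≈ᴹ-trans (≈ᴹ-sym (*ₗ-distribʳ x s (- s))) (≈ᴹ-trans (*ₗ-congʳ (-‿inverseʳ s)) (*ₗ-zeroˡ x))

  Independent : ∀ {d} → Vector Carrierᴹ d → Set _
  Independent b = ∀ a → linComb a b ≈ᴹ 0ᴹ → ∀ i → a i ≈ 0#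

  linComb-injective : ∀ {d} {b : Vector Carrierᴹ d} → Independent b → ∀ a a′ → linComb a b ≈ᴹ linComb a′ b → ∀ i →
    a i ≈ a′ i
  linComb-injective {b = b} ind a a′ e i = x∙y⁻¹≈ε⇒x≈y (a i) (a′ i)
    (≈-trans (+-congˡ (≈-sym (-1*x≈-x (a′ i)))) (ind (λ i → a i +ᵏ (- 1#) *ᵏ a′ i) zero-comb i))
    where
    open SetoidReasoning ≈ᴹ-setoid
    zero-comb : linComb (λ i → a i +ᵏ (- 1#) *ᵏ a′ i) b ≈ᴹ 0ᴹ
    zero-comb = begin
      linComb (λ i → a i +ᵏ (- 1#) *ᵏ a′ i) b                   ≈⟨ linComb-+ a (λ i → (- 1#) *ᵏ a′ i) b ⟩
      linComb a b +ᴹ linComb (λ i → (- 1#) *ᵏ a′ i) b          ≈⟨ +ᴹ-cong (≈ᴹ-trans e (≈ᴹ-sym (*ₗ-identityˡ _)))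
        (linComb-* (- 1#) a′ b) ⟩
      1# *ₗ linComb a′ b +ᴹ (- 1#) *ₗ linComb a′ b            ≈⟨ *ₗ-cancel 1# (linComb a′ b) ⟩
      0ᴹ                                                      ∎

  -- Comparing indices decides whether the coefficient of `x` vanishes. If it does, independence of
  -- `b` applies; if not, dividing by it would express `x` through `b`.
  independent-∷ᵛ : ∀ {d} {b : Vector Carrierᴹ d} {x} → Independent b → (∀ a → ¬ x ≈ᴹ linComb a b) → Independent (x ∷ᵛ b)
  independent-∷ᵛ {b = b} {x} ind x∉ a e = coefficients (index (a zero) ≟ index 0#)
    where
    open SetoidReasoning ≈ᴹ-setoid
    L : Carrierᴹ
    L = linComb (a ∘ suc) b
    coefficients : Dec (index (a zero) ≡ index 0#) → ∀ i → a i ≈ 0#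
    coefficients (yes e₀) zero    = index-injective e₀
    coefficients (yes e₀) (suc i) = ind (a ∘ suc) (begin
      L                     ≈⟨ +ᴹ-identityˡ L ⟨
      0ᴹ +ᴹ L               ≈⟨ +ᴹ-congʳ (*ₗ-zeroˡ x) ⟨
      0# *ₗ x +ᴹ L          ≈⟨ +ᴹ-congʳ (*ₗ-congʳ (index-injective e₀)) ⟨
      a zero *ₗ x +ᴹ L      ≈⟨ e ⟩
      0ᴹ                    ∎) i
    coefficients (no a₀≢0) with invertible (a zero) (λ a₀≈0 → a₀≢0 (index-cong a₀≈0))
    ... | y , a₀y≈1 = λ _ → contradiction (begin
      x                                             ≈⟨ +ᴹ-identityʳ x ⟨
      x +ᴹ 0ᴹ                                       ≈⟨ +ᴹ-congˡ (*ₗ-cancel y L) ⟨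
      x +ᴹ (y *ₗ L +ᴹ (- y) *ₗ L)                   ≈⟨ +ᴹ-assoc x (y *ₗ L) ((- y) *ₗ L) ⟨
      (x +ᴹ y *ₗ L) +ᴹ (- y) *ₗ L                   ≈⟨ +ᴹ-congʳ (+ᴹ-congʳ (begin
          x                       ≈⟨ *ₗ-identityˡ x ⟨
          1# *ₗ x                 ≈⟨ *ₗ-congʳ (≈-trans (*-comm y (a zero)) a₀y≈1) ⟨
          (y *ᵏ a zero) *ₗ x       ≈⟨ *ₗ-assoc y (a zero) x ⟩
          y *ₗ (a zero *ₗ x)      ∎)) ⟩
      (y *ₗ (a zero *ₗ x) +ᴹ y *ₗ L) +ᴹ (- y) *ₗ L  ≈⟨ +ᴹ-congʳ (*ₗ-distribˡ y (a zero *ₗ x) L) ⟨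
      y *ₗ (a zero *ₗ x +ᴹ L) +ᴹ (- y) *ₗ L         ≈⟨ +ᴹ-congʳ (≈ᴹ-trans (*ₗ-congˡ e) (*ₗ-zeroʳ y)) ⟩
      0ᴹ +ᴹ (- y) *ₗ L                              ≈⟨ +ᴹ-identityˡ _ ⟩
      (- y) *ₗ L                                    ≈⟨ linComb-* (- y) (a ∘ suc) b ⟨
      linComb (λ i → (- y) *ᵏ a (suc i)) b           ∎) (x∉ (λ i → (- y) *ᵏ a (suc i)))

  spanSubspace : ∀ {d} → Vector Carrierᴹ d → Subspace _
  spanSubspace b = record
    { carrier  = λ x → ∃ λ a → x ≈ᴹ linComb a b
    ; resp-≈   = λ x≈y (a , e) → a , ≈ᴹ-trans (≈ᴹ-sym x≈y) e
    ; 0-closed = (λ _ → 0#) , ≈ᴹ-sym (linComb-zero b)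
    ; +-closed = λ (a , e) (a′ , e′) → (λ i → a i +ᵏ a′ i) , ≈ᴹ-trans (+ᴹ-cong e e′) (≈ᴹ-sym (linComb-+ a a′ b))
    ; *-closed = λ s (a , e) → (λ i → s *ᵏ a i) , ≈ᴹ-trans (*ₗ-congˡ e) (≈ᴹ-sym (linComb-* s a b))
    }

  -- Reading the base-q digits of an index as coefficients numbers the vectors of a span, without
  -- repetition when `b` is independent.
  combination : ∀ {d} → Vector Carrierᴹ d → Fin (q ^ d) → Carrierᴹ
  combination b i = linComb (scalar ∘ finToFun i) b

  combination-code : ∀ {d} (a : Vector Scalar d) (b : Vector Carrierᴹ d) → combination b
    (funToFin (index ∘ a)) ≈ᴹ linComb a b
  combination-code a b = linComb-cong b λ i → ≈-trans (≈-reflexive (cong scalar (finToFun-funToFin (index ∘ a) i)))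
    (scalar-index (a i))

  combination-injective : ∀ {d} {b : Vector Carrierᴹ d} → Independent b → ∀ {i j} →
    combination b i ≈ᴹ combination b j → i ≡ j
  combination-injective ind {i} {j} e = finToFun-injective λ l →
    trans (sym (index-scalar _)) (trans (index-cong (linComb-injective ind (scalar ∘ finToFun i)
      (scalar ∘ finToFun j) e l)) (index-scalar _))

  module Coordinates {n : ℕ} (V-dim : HasDim whole n) where

    open IsBasis (proj₂ V-dim) using () renaming (independent to basis-independent; spanning to basis-spanning)

    N : ℕ
    N = q ^ n

    -- Together with `idx` this identifies the vectors, up to `≈ᴹ`, with `Fin N`.
    vec : Fin N → Carrierᴹ
    vec = combination (proj₁ V-dim)

    idx : Carrierᴹ → Fin N
    idx x = funToFin (index ∘ proj₁ (basis-spanning {x} tt))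

    vec-idx : ∀ x → vec (idx x) ≈ᴹ x
    vec-idx x = let (a , e) = basis-spanning {x} tt in ≈ᴹ-trans (combination-code a (proj₁ V-dim)) (≈ᴹ-sym e)

    idx-cong : ∀ {x y} → x ≈ᴹ y → idx x ≡ idx y
    idx-cong {x} {y} x≈y = combination-injective basis-independent
      (≈ᴹ-trans (vec-idx x) (≈ᴹ-trans x≈y (≈ᴹ-sym (vec-idx y))))

    idx-vec : ∀ i → idx (vec i) ≡ i
    idx-vec i = combination-injective basis-independent (vec-idx (vec i))

    idx-injective : ∀ {x y} → idx x ≡ idx y → x ≈ᴹ y
    idx-injective {x} {y} e = ≈ᴹ-trans (≈ᴹ-sym (vec-idx x)) (≈ᴹ-trans (≈ᴹ-reflexive (cong vec e)) (vec-idx y))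

    span : ∀ {d} → Vector Carrierᴹ d → Fin N → Bool
    span b x = does (any? λ i → idx (combination b i) ≟ x)

    span-intro : ∀ {d} {b : Vector Carrierᴹ d} {x} → carrier (spanSubspace b) (vec x) → span b x ≡ true
    span-intro {b = b} {x} (a , e) = dec-true (any? λ i → idx (combination b i) ≟ x)
      (funToFin (index ∘ a) , trans (idx-cong (≈ᴹ-trans (combination-code a b) (≈ᴹ-sym e))) (idx-vec x))

    span-elim : ∀ {d} {b : Vector Carrierᴹ d} {x} → span b x ≡ true → carrier (spanSubspace b) (vec x)
    span-elim {b = b} {x} e = let (i , eᵢ) = does-true (any? λ i → idx (combination b i) ≟ x) e in
      scalar ∘ finToFun i , ≈ᴹ-trans (≈ᴹ-reflexive (cong vec (sym eᵢ))) (vec-idx _)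

    card-span : ∀ {d} (b : Vector Carrierᴹ d) → Independent b → card (span b) ≡ q ^ d
    card-span b ind = image-card (idx ∘ combination b) (span b)
      (λ e → combination-injective ind (idx-injective e))
      (λ i → dec-true (any? λ j → idx (combination b j) ≟ idx (combination b i)) (i , refl))
      (λ x → does-true (any? λ i → idx (combination b i) ≟ x))

    -- Closure is stated on indices, over finite types, so that it can be decided.
    IsSub : (Fin N → Bool) → Set
    IsSub P = P (idx 0ᴹ) ≡ true
            × (∀ x → P x ≡ true → ∀ y → P y ≡ true → P (idx (vec x +ᴹ vec y)) ≡ true)
            × (∀ (s : Fin q) x → P x ≡ true → P (idx (scalar s *ₗ vec x)) ≡ true)

    IsSub? : ∀ P → Dec (IsSub P)
    IsSub? P = (P (idx 0ᴹ) ≟ᵇ true)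
      ×-dec (all? λ x → (P x ≟ᵇ true) →-dec (all? λ y → (P y ≟ᵇ true) →-dec (P (idx (vec x +ᴹ vec y)) ≟ᵇ true)))
      ×-dec (all? λ s → all? λ x → (P x ≟ᵇ true) →-dec (P (idx (scalar s *ₗ vec x)) ≟ᵇ true))

    _characterises_ : ∀ {p} → (Fin N → Bool) → Subspace p → Set _
    P characterises W = ∀ x → (P (idx x) ≡ true → carrier W x) × (carrier W x → P (idx x) ≡ true)

    characteristic⇒IsSub : ∀ {p} {P} (W : Subspace p) → P characterises W → IsSub P
    characteristic⇒IsSub {P = P} W char = proj₂ (char 0ᴹ) (0-closed W)
      , (λ x Px y Py → proj₂ (char _) (+-closed W (member x Px) (member y Py)))
      , (λ s x Px → proj₂ (char _) (*-closed W (scalar s) (member x Px)))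
      where
      member : ∀ x → P x ≡ true → carrier W (vec x)
      member x Px = proj₁ (char (vec x)) (trans (cong P (idx-vec x)) Px)

    -- `Lift` moves the Boolean condition to the level `p` at which the members of the given family
    -- live.
    subspaceOf : ∀ p {P} → IsSub P → Subspace p
    subspaceOf p {P} (zero∈ , +∈ , *∈) = record
      { carrier  = λ x → Lift p (P (idx x) ≡ true)
      ; resp-≈   = λ x≈y (lift e) → lift (trans (cong P (sym (idx-cong x≈y))) e)
      ; 0-closed = lift zero∈
      ; +-closed = λ (lift e) (lift e′) → lift (trans (cong P (idx-cong (≈ᴹ-sym (+ᴹ-cong (vec-idx _) (vec-idx _)))))
        (+∈ _ e _ e′))
      ; *-closed = λ a (lift e) → lift (trans (cong P (idx-cong (≈ᴹ-sym (*ₗ-cong (scalar-index a) (vec-idx _)))))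
        (*∈ (index a) _ e))
      }

    characterises-subspaceOf : ∀ p {P} (sub : IsSub P) → P characterises subspaceOf p sub
    characterises-subspaceOf p sub x = lift , Level.lower

    span-characterises : ∀ {d} (b : Vector Carrierᴹ d) → span b characterises spanSubspace b
    span-characterises b x =
      (λ e → resp-≈ (spanSubspace b) (vec-idx x) (span-elim {b = b} e)) ,
      (λ e → span-intro {b = b} (resp-≈ (spanSubspace b) (≈ᴹ-sym (vec-idx x)) e))

    span-IsSub : ∀ {d} (b : Vector Carrierᴹ d) → IsSub (span b)
    span-IsSub b = characteristic⇒IsSub (spanSubspace b) (span-characterises b)

    span-least : ∀ {d} {b : Vector Carrierᴹ d} {P} → IsSub P → (∀ i → P (idx (b i)) ≡ true) → span b ⊑ P
    span-least {b = b} {P} sub mem x e with span-elim {b = b} e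
    ... | a , eₓ with linComb-member (subspaceOf Level.zero sub) a {b} (lift ∘ mem)
    ...   | lift Pa = trans (cong P (trans (sym (idx-vec x)) (idx-cong eₓ))) Pa

    span-member : ∀ {d} (b : Vector Carrierᴹ d) i → span b (idx (b i)) ≡ true
    span-member b i = proj₂ (span-characterises b (b i)) (linComb-unit b i)

    span-∉ : ∀ {d} (b : Vector Carrierᴹ d) {x} → span b x ≡ false → ∀ a → ¬ vec x ≈ᴹ linComb a b
    span-∉ b e a e′ = true≢false (span-intro {b = b} (a , e′)) e

    IsBasisOf : ∀ {d} → Vector Carrierᴹ d → (Fin N → Bool) → Set _
    IsBasisOf b P = Independent b × span b ≗ P

    -- Greedy extension: while the span of the vectors found misses a vector of `P`, that vector is
    -- added. It ends by dimension `n`, because n + 1 independent vectors would span q ^ (n + 1) of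
    -- only q ^ n vectors.
    exists-basis : ∀ {P} → IsSub P → ∃ λ d → ∃ λ (b : Vector Carrierᴹ d) → IsBasisOf b P
    exists-basis {P} sub with grow (suc n)
      where
      grow : ∀ i → (∃ λ (b : Vector Carrierᴹ i) → Independent b × (∀ j → P (idx (b j)) ≡ true)) ⊎
                   (∃ λ d → ∃ λ (b : Vector Carrierᴹ d) → IsBasisOf b P)
      grow zero = inj₁ ((λ ()) , (λ _ _ ()) , λ ())
      grow (suc i) with grow i
      ... | inj₂ done = inj₂ done
      ... | inj₁ (b , ind , mem) with any? (λ x → (P x ≟ᵇ true) ×-dec (span b x ≟ᵇ false))
      ...   | yes (x , Px , x∉) = inj₁ (vec x ∷ᵛ b , independent-∷ᵛ {b = b} ind (span-∉ b x∉) ,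
                λ { zero → trans (cong P (idx-vec x)) Px ; (suc j) → mem j })
      ...   | no none = inj₂ (i , b , ind , ⊑-antisym (span-least {b = b} sub mem)
                λ x Px → ¬-not λ x∉ → none (x , Px , x∉))
    ... | inj₂ basis = basis
    ... | inj₁ (b , ind , _) = contradiction
      (subst₂ _≤_ (card-span b ind) (card-true N) (card-mono (span b) (λ _ → true) λ _ _ → refl))
      (ℕ.<⇒≱ (ℕ.^-monoʳ-< q (s≤s 1≤r) (ℕ.n<1+n n)))

    IsSub-∩ : ∀ {P Q} → IsSub P → IsSub Q → IsSub (P ∩ Q)
    IsSub-∩ {P} {Q} (z , a , s) (z′ , a′ , s′) = ∧-intro z z′
      , (λ x ex y ey → let (Px , Qx) = ∧-true (P x) ex ; (Py , Qy) = ∧-true (P y) ey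
                       in ∧-intro (a x Px y Py) (a′ x Qx y Qy))
      , (λ k x e → let (Px , Qx) = ∧-true (P x) e in ∧-intro (s k x Px) (s′ k x Qx))

    geometry : Geometry r n N
    geometry = record
      { card-points = refl
      ; IsSub       = IsSub
      ; IsSub?      = IsSub?
      ; IsSub-resp  = λ P≗Q (z , a , s) → trans (sym (P≗Q _)) z
                        , (λ x Qx y Qy → trans (sym (P≗Q _)) (a x (trans (P≗Q x) Qx) y (trans (P≗Q y) Qy)))
                        , (λ k x Qx → trans (sym (P≗Q _)) (s k x (trans (P≗Q x) Qx)))
      ; IsSub-∩     = IsSub-∩
      ; dimension   = λ sub → let (d , b , ind , e) = exists-basis sub in d , trans (sym (card-cong e))
        (card-span b ind)
      ; origin      = span []ᵛ , span-IsSub []ᵛ , card-span []ᵛ (λ _ _ ()) , λ sub → span-least {b = []ᵛ} sub λ ()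
      ; adjoin      = λ {P} x sub x∉P → let (d , b , ind , e) = exists-basis sub in
                        span (vec x ∷ᵛ b) , span-IsSub (vec x ∷ᵛ b)
                        , trans (card-span (vec x ∷ᵛ b) (independent-∷ᵛ {b = b} ind (span-∉ b (trans (e x) x∉P))))
                                  (cong (q *_) (trans (sym (card-span b ind)) (card-cong e)))
                        , (λ y Py → span-least {b = b} (span-IsSub (vec x ∷ᵛ b))
                          (λ i → span-member (vec x ∷ᵛ b) (suc i)) y (trans (e y) Py))
                        , trans (cong (span (vec x ∷ᵛ b)) (sym (idx-vec x))) (span-member (vec x ∷ᵛ b) zero)
                        , λ {Q} subQ P⊑Q Qx → span-least {b = vec x ∷ᵛ b} subQ
                            λ { zero → trans (cong Q (idx-vec x)) Qx
                              ; (suc i) → P⊑Q _ (trans (sym (e _)) (span-member b i)) }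
      }

-- Enumerating subsets and repetition-free lists

choose : ∀ {n} (P : Fin n → Bool) → Fin (card P) → Fin n
choose {suc n} P j with P zero
choose {suc n} P zero    | true  = zero
choose {suc n} P (suc j) | true  = suc (choose (P ∘ suc) j)
choose {suc n} P j       | false = suc (choose (P ∘ suc) j)

choose-true : ∀ {n} (P : Fin n → Bool) j → P (choose P j) ≡ true
choose-true {suc n} P j with P zero in eq
choose-true {suc n} P zero    | true  = eq
choose-true {suc n} P (suc j) | true  = choose-true (P ∘ suc) j
choose-true {suc n} P j       | false = choose-true (P ∘ suc) j

choose-injective : ∀ {n} (P : Fin n → Bool) {j j′} → choose P j ≡ choose P j′ → j ≡ j′
choose-injective {suc n} P {j} {j′} e with P zero
choose-injective {suc n} P {zero}  {zero}   e | true  = refl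
choose-injective {suc n} P {suc j} {suc j′} e | true  = cong suc (choose-injective (P ∘ suc) (suc-injective e))
choose-injective {suc n} P {j}     {j′}     e | false = choose-injective (P ∘ suc) (suc-injective e)

lookup-injective : ∀ {a ℓ} (S : Setoid a ℓ) {xs} → Unique.Unique S xs →
  ∀ i j → Setoid._≈_ S (lookup xs i) (lookup xs j) → i ≡ j
lookup-injective S (_ AllPairs.∷ _) zero zero _ = refl
lookup-injective S (x∉ AllPairs.∷ _) zero (suc j) e = contradiction e
  (All.lookupₛ S resp x∉ (Membershipₚ.∈-lookup S _ j))
  where
  resp : ∀ {y z} → Setoid._≈_ S y z → ¬ Setoid._≈_ S _ y → ¬ Setoid._≈_ S _ z
  resp y≈z x≉y x≈z = x≉y (Setoid.trans S x≈z (Setoid.sym S y≈z))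
lookup-injective S (x∉ AllPairs.∷ u) (suc i) zero e = sym (lookup-injective S (x∉ AllPairs.∷ u) zero (suc i)
  (Setoid.sym S e))
lookup-injective S (_ AllPairs.∷ u) (suc i) (suc j) e = cong suc (lookup-injective S u i j e)

δ-≢ : ∀ m n → ¬ m ≡ n → δ m n ≡ 0
δ-≢ m n m≢n with m ≡ᵇ n in eq
... | false = refl
... | true  = contradiction (ℕ.≡ᵇ⇒≡ m n (subst T (sym eq) _)) m≢n

-- Subspaces as Boolean functions on the vectors

module Correspondence {r n : ℕ} {c ℓ m ℓm : Level} (p : Level) (K : FiniteField (suc r) c ℓ)
  (V : Module (FiniteField.commutativeRing K) m ℓm) (V-dim : Subspaces.HasDim K V (Subspaces.whole K V) n) where

  open Module V using (_≈ᴹ_; ≈ᴹ-sym; ≈ᴹ-trans; ≈ᴹ-reflexive)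
  open Subspaces K V
  open LinearAlgebra K V
  open Coordinates V-dim
  open Powers r using (q; ^-injective; module Counts; wide-condition)

  member : ∀ {k} → Gr p k → Fin N → Bool
  member F = span (proj₁ (hasDim F))

  member-characterises : ∀ {k} (F : Gr p k) → member F characterises subspace F
  member-characterises F x =
    (λ e → let (a , eₓ) = span-elim {b = b} e in
      resp-≈ (subspace F) (≈ᴹ-trans (≈ᴹ-sym eₓ) (vec-idx x)) (linComb-member (subspace F) a members)) ,
    (λ x∈F → let (a , eₓ) = spanning x∈F in span-intro {b = b} (a , ≈ᴹ-trans (vec-idx x) eₓ))
    where
    b = proj₁ (hasDim F)
    open IsBasis (proj₂ (hasDim F))

  member-IsSub : ∀ {k} (F : Gr p k) → IsSub (member F)
  member-IsSub F = span-IsSub (proj₁ (hasDim F))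

  card-member : ∀ {k} (F : Gr p k) → card (member F) ≡ q ^ k
  card-member F = card-span (proj₁ (hasDim F)) (IsBasis.independent (proj₂ (hasDim F)))

  ⊑⇒⊆ : ∀ {P Q} {W W′ : Subspace p} → P characterises W → Q characterises W′ → P ⊑ Q → ∀ {x} → carrier W x →
    carrier W′ x
  ⊑⇒⊆ P≈W Q≈W′ P⊑Q {x} x∈W = proj₁ (Q≈W′ x) (P⊑Q _ (proj₂ (P≈W x) x∈W))

  ⊆⇒⊑ : ∀ {P Q} {W W′ : Subspace p} → P characterises W → Q characterises W′ → (∀ {x} → carrier W x → carrier W′ x) →
    P ⊑ Q
  ⊆⇒⊑ {P} {Q} P≈W Q≈W′ W⊆W′ x Px = trans (cong Q (sym (idx-vec x)))
    (proj₂ (Q≈W′ (vec x)) (W⊆W′ (proj₁ (P≈W (vec x)) (trans (cong P (idx-vec x)) Px))))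

  ≤ˢ⇒⊑ : ∀ {k l} (F : Gr p k) (G : Gr p l) → F ≤ˢ G → member F ⊑ member G
  ≤ˢ⇒⊑ F G F≤G = ⊆⇒⊑ {member F} {member G} {subspace F} {subspace G} (member-characterises F)
    (member-characterises G) F≤G

  ⊑⇒≤ˢ : ∀ {k l} (F : Gr p k) (G : Gr p l) → member F ⊑ member G → F ≤ˢ G
  ⊑⇒≤ˢ F G F⊑G = ⊑⇒⊆ {member F} {member G} {subspace F} {subspace G} (member-characterises F)
    (member-characterises G) F⊑G

  basis⇒IsBasis : ∀ {d P} {W : Subspace p} (b : Vector (Module.Carrierᴹ V) d) → IsBasisOf b P → P characterises W →
    IsBasis W b
  basis⇒IsBasis {P = P} b (ind , e) P≈W = record
    { members     = λ i → proj₁ (P≈W _) (trans (sym (e _)) (span-member b i))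
    ; independent = ind
    ; spanning    = λ {x} x∈W → proj₁ (span-characterises b x) (trans (e _) (proj₂ (P≈W x) x∈W))
    }

  -- Some basis of `P` has d′ vectors, so q ^ d′ = card P = q ^ d, and q ≥ 2 forces d′ = d.
  card⇒dim : ∀ {d P W} → (sub : IsSub P) → card P ≡ q ^ d → P characterises W → HasDim {p} W d
  card⇒dim {d} {P} {W} sub cP P≈W with exists-basis sub
  ... | d′ , b , basis@(ind , e) with d≡
    where
    d≡ : d′ ≡ d
    d≡ = ^-injective 1≤r (trans (sym (card-span b ind)) (trans (card-cong e) cP))
  ...   | refl = b , basis⇒IsBasis {W = W} b basis P≈W

  toGr : ∀ {d P} → IsSub P → card P ≡ q ^ d → Gr p d
  toGr sub cP = record
    { subspace = subspaceOf p sub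
    ; hasDim   = card⇒dim {W = subspaceOf p sub} sub cP (characterises-subspaceOf p sub)
    }

  meet-characterises : ∀ {k l} (F : Gr p k) (G : Gr p l) → (member F ∩ member G) characterises (subspace F ⊓ subspace G)
  meet-characterises F G x =
    (λ e → let (f , g) = ∧-true (member F (idx x)) e in proj₁ (member-characterises F x) f , proj₁
      (member-characterises G x) g) ,
    (λ (f , g) → ∧-intro (proj₂ (member-characterises F x) f) (proj₂ (member-characterises G x) g))

  small⇒DimLess : ∀ {k t} (F G : Gr p k) → card (member F ∩ member G) < q ^ t → DimLess (subspace F ⊓ subspace G) t
  small⇒DimLess {t = t} F G small = less (exists-basis P-sub)
    where
    P : Fin N → Bool
    P = member F ∩ member G
    P-sub : IsSub P
    P-sub = IsSub-∩ {member F} {member G} (member-IsSub F) (member-IsSub G)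
    less : (∃ λ d → ∃ λ (b : Vector (Module.Carrierᴹ V) d) → IsBasisOf b P) → DimLess (subspace F ⊓ subspace G) t
    less (d , b , basis@(ind , e)) = d , (b , basis⇒IsBasis {P = P} {W = subspace F ⊓ subspace G} b basis
      (meet-characterises F G)) ,
      ℕ.≰⇒> λ t≤d → ℕ.<⇒≱ small (ℕ.≤-trans (ℕ.^-monoʳ-≤ q t≤d)
        (ℕ.≤-reflexive (trans (sym (card-span b ind)) (card-cong e))))

  ¬DimLess : ∀ {k t E} (F G : Gr p k) → card E ≡ q ^ t → E ⊑ member F → E ⊑ member G → ¬ DimLess
    (subspace F ⊓ subspace G) t
  ¬DimLess {t = t} {E} F G cE E⊑F E⊑G (d , (b , basis) , d<t) = ℕ.<⇒≱ (ℕ.^-monoʳ-< q (s≤s 1≤r) d<t) (begin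
    q ^ t           ≡⟨ cE ⟨
    card E          ≤⟨ card-mono E (span b) (λ x Ex → span-intro {b = b} {x} (IsBasis.spanning basis {vec x}
                         (  proj₁ (member-characterises F (vec x)) (trans (cong (member F) (idx-vec x)) (E⊑F x Ex))
                         ,  proj₁ (member-characterises G (vec x)) (trans (cong (member G) (idx-vec x)) (E⊑G x Ex))))) ⟩
    card (span b)   ≡⟨ card-span b (IsBasis.independent basis) ⟩
    q ^ d           ∎)
    where open ℕ.≤-Reasoning

  -- Any two members share the t-space `E`, so the premise that they meet in dimension below `t` is
  -- never met.
  star-almost : ∀ {k t E} (𝓖 : Family p k) → card E ≡ q ^ t → (∀ {F} → F ∈ᶠ 𝓖 → E ⊑ member F) → AlmostIntersecting t 𝓖
  star-almost 𝓖 cE E⊑ {F} {F₁} F∈ F₁∈ _ less _ = ⊥-elim (¬DimLess F F₁ cE (E⊑ {F} F∈) (E⊑ {F₁} F₁∈) less)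

  -- A maximum family is a star

  module _ (k t : ℕ) (t<k : suc t ≤ k) (k≤n : k ≤ n) (𝓕 : Family p k) (maximum : IsMaximumAlmostIntersecting t 𝓕) where

    open Counts 1≤r n k k≤n
    open Incidence 1≤r geometry k k≤n

    𝕊 = Gr-setoid p k

    star-member : ∀ E → Fin (card (isSuper E)) → Gr p k
    star-member E j = let (s , c , _) = isSuper⇒ {E} {choose (isSuper E) j} (choose-true (isSuper E) j) in toGr s c

    star-member-characterises : ∀ E j → decode (choose (isSuper E) j) characterises subspace (star-member E j)
    star-member-characterises E j = characterises-subspaceOf p
      (proj₁ (isSuper⇒ {E} {choose (isSuper E) j} (choose-true (isSuper E) j)))

    -- The competitor in the comparison with `𝓕`: all k-spaces through `E`, listed from the codes
    -- that satisfy `isSuper E`.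
    star : (Fin N → Bool) → Family p k
    star E = record
      { elements = tabulate G
      ; unique   = Uniqueₚ.tabulate⁺ 𝕊 λ {i} {j} (i⊆j , j⊆i) → choose-injective (isSuper E) (decode-injective (⊑-antisym
                     (⊆⇒⊑ {W = subspace (G i)} {subspace (G j)} (G-char i) (G-char j) i⊆j)
                     (⊆⇒⊑ {W = subspace (G j)} {subspace (G i)} (G-char j) (G-char i) j⊆i)))
      }
      where
      G : Fin (card (isSuper E)) → Gr p k
      G = star-member E
      G-char : ∀ j → decode (choose (isSuper E) j) characterises subspace (G j)
      G-char = star-member-characterises E

    star-size : ∀ E → size (star E) ≡ card (isSuper E)
    star-size E = length-tabulate (star-member E)

    star-⊑ : ∀ {E F} → F ∈ᶠ star E → E ⊑ member F
    star-⊑ {E} {F} F∈ x Ex = let (j , (_ , G⊆F)) = Membershipₚ.∈-tabulate⁻ 𝕊 {f = star-member E} {v = F} F∈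
                                 (_ , _ , E⊑) = isSuper⇒ {E} {choose (isSuper E) j} (choose-true (isSuper E) j) in
      ⊆⇒⊑ {W = subspace (star-member E j)} {subspace F} (star-member-characterises E j) (member-characterises F) G⊆F x
        (E⊑ x Ex)

    M : ℕ
    M = size 𝓕

    𝓕[_] : Fin M → Gr p k
    𝓕[ j ] = lookup (elements 𝓕) j

    𝓕-injective : ∀ i j → member 𝓕[ i ] ≗ member 𝓕[ j ] → i ≡ j
    𝓕-injective i j e = lookup-injective 𝕊 (unique 𝓕) i j
      ( ⊑⇒≤ˢ 𝓕[ i ] 𝓕[ j ] (λ x → trans (sym (e x)))
      , ⊑⇒≤ˢ 𝓕[ j ] 𝓕[ i ] (λ x → trans (e x)))

    open SubspaceFamily (member ∘ 𝓕[_]) (member-IsSub ∘ 𝓕[_]) (card-member ∘ 𝓕[_]) 𝓕-injective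

    𝓕-∈ : ∀ j → 𝓕[ j ] ∈ᶠ 𝓕
    𝓕-∈ = Membershipₚ.∈-lookup 𝕊 (elements 𝓕)

    𝓕-almost : ∀ i j₁ j₂ → card (member 𝓕[ i ] ∩ member 𝓕[ j₁ ]) < q ^ t → card
      (member 𝓕[ i ] ∩ member 𝓕[ j₂ ]) < q ^ t → j₁ ≡ j₂
    𝓕-almost i j₁ j₂ s₁ s₂ = lookup-injective 𝕊 (unique 𝓕) j₁ j₂
      (proj₁ maximum {𝓕[ i ]} {𝓕[ j₁ ]} {𝓕[ j₂ ]} (𝓕-∈ i) (𝓕-∈ j₁) (𝓕-∈ j₂) (small⇒DimLess 𝓕[ i ] 𝓕[ j₁ ] s₁)
        (small⇒DimLess 𝓕[ i ] 𝓕[ j₂ ] s₂))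

    open Covers t t<k 𝓕-almost

    𝓕-large : supers t (k ∸ t) ≤ M
    𝓕-large = bound (subspace-of-dim t (ℕ.≤-trans (ℕ.<⇒≤ t<k) k≤n))
      where
      bound : (∃ λ E → IsSub E × card E ≡ q ^ t) → supers t (k ∸ t) ≤ M
      bound (E , sub , cE) = begin
        supers t (k ∸ t)    ≤⟨ supers-≤-card t (k ∸ t) (ℕ.m+[n∸m]≡n (ℕ.<⇒≤ t<k)) E sub cE ⟩
        card (isSuper E)    ≡⟨ star-size E ⟨
        size (star E)       ≤⟨ proj₂ maximum (star E) (λ {F} {F₁} {F₂} → star-almost {k} {t} {E} (star E) cE
          (λ {F} → star-⊑ {E} {F}) {F} {F₁} {F₂}) ⟩
        M                   ∎
        where open ℕ.≤-Reasoning

    -- `star-centre` puts the family inside the star of `E`. Conversely, a k-space through `E`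
    -- outside the family could be added to it, against maximality.
    is-star : Admissible → ∃ λ (E : Gr p t) → ∀ (F : Gr p k) → F ∈ᶠ 𝓕 ⇔ E ≤ˢ F
    is-star adm = conclude (star-centre adm 𝓕-large)
      where
      conclude : (∃ λ E → IsSub E × card E ≡ q ^ t × ∀ j → E ⊑ member 𝓕[ j ]) → ∃ λ (E : Gr p t) → ∀ (F : Gr p k) →
        F ∈ᶠ 𝓕 ⇔ E ≤ˢ F
      conclude (E , sub , cE , E⊑) = toGr {t} sub cE , λ F → mk⇔ (λ F∈ {x} → to F F∈ {x}) (from F)
        where
        E≈ : E characterises subspaceOf p sub
        E≈ = characterises-subspaceOf p sub
        ∈⇒⊑ : ∀ {F} → F ∈ᶠ 𝓕 → E ⊑ member F
        ∈⇒⊑ {F} F∈ x Ex =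
          ≤ˢ⇒⊑ G F (proj₂ (Anyₚ.lookup-index F∈)) x (E⊑ (Any.index F∈) x Ex)
          where
          G : Gr p k
          G = 𝓕[ Any.index F∈ ]
        to : ∀ F → F ∈ᶠ 𝓕 → toGr {t} sub cE ≤ˢ F
        to F F∈ = ⊑⇒⊆ {E} {member F} {subspaceOf p sub} {subspace F} E≈ (member-characterises F) (∈⇒⊑ {F} F∈)
        from : ∀ F → toGr {t} sub cE ≤ˢ F → F ∈ᶠ 𝓕
        -- Comparing characteristic functions decides whether `F` belongs to the family.
        from F E≤F with Any.any? (λ G → all? λ x → member F x ≟ᵇ member G x) (elements 𝓕)
        ... | yes F∈ = Any.map {Q = Setoid._≈_ 𝕊 F} (λ {G} → same G) F∈
          where
          same : ∀ G → (∀ x → member F x ≡ member G x) → Setoid._≈_ 𝕊 F G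
          same G e =
            ⊑⇒≤ˢ F G (λ x → trans (sym (e x))) ,
            ⊑⇒≤ˢ G F (λ x → trans (e x))
        ... | no F∉ = contradiction (proj₂ maximum bigger (λ {F} {F₁} {F₂} → star-almost {k} {t} {E} bigger cE
            (λ {G} → E⊑′ {G}) {F} {F₁} {F₂})) (ℕ.<⇒≱ (ℕ.n<1+n M))
          where
          bigger : Family p k
          bigger = record
            { elements = F ∷ elements 𝓕
            ; unique   = All.map (λ {G} ¬e (F⊆ , ⊆F) → ¬e (⊑-antisym
                           (≤ˢ⇒⊑ F G F⊆)
                           (≤ˢ⇒⊑ G F ⊆F)))
                         (¬Any⇒All¬ (elements 𝓕) F∉) AllPairs.∷ unique 𝓕
            }
          E⊑′ : ∀ {G} → G ∈ᶠ bigger → E ⊑ member G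
          E⊑′ {G} (here (_ , F⊆G)) = ⊆⇒⊑ {E} {member G} {subspaceOf p sub} {subspace G} E≈ (member-characterises G)
            (λ x∈E → F⊆G (E≤F x∈E))
          E⊑′ {G} (there G∈) = ∈⇒⊑ {G} G∈

    -- For k = t + 1 the delta term is dropped. Otherwise `δ k (t + 1)` is 0, and the term is 1
    -- exactly for q = 2.
    admissible : 2 * k + 1 + δ 2 q * (1 ∸ δ k (t + 1)) ≤ n → Admissible
    admissible hyp with suc t ℕ.≟ k
    ... | yes t+1≡k = inj₂ (t+1≡k , ℕ.m+n≤o⇒m≤o (2 * k + 1) hyp)
    ... | no  t+1≢k = inj₁ (wide-condition 1≤r n k t t<k (size-condition r 1≤r hyp))
      where
      -- The variable `s` stands for `r`, so that the split into q > 2 and q = 2 makes `δ 2 (suc s)`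
      -- compute.
      size-condition : ∀ s → 1 ≤ s → 2 * k + 1 + δ 2 (suc s) * (1 ∸ δ k (t + 1)) ≤ n → (1 < s × 2 * k + 1 ≤ n) ⊎
        (s ≡ 1 × 2 * k + 2 ≤ n)
      size-condition (suc (suc s)) _ hyp = inj₁ (s≤s (s≤s z≤n) , ℕ.m+n≤o⇒m≤o (2 * k + 1) hyp)
      size-condition (suc zero)    _ hyp = inj₂ (refl , subst (_≤ n) (ℕ.+-assoc (2 * k) 1 1)
        (subst (λ z → 2 * k + 1 + 1 * (1 ∸ z) ≤ n) (δ-≢ k (t + 1) λ k≡ → t+1≢k (trans (ℕ.+-comm 1 t) (sym k≡))) hyp))

theorem1p1 : ∀ {c ℓ m ℓm p : Level} (q n k t : ℕ) → IsPrimePower q →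
    0 < n → 0 < k → 0 < t →
    t + 1 ≤ k →
    2 * k + 1 + δ 2 q * (1 ∸ δ k (t + 1)) ≤ n →
    (K : FiniteField q c ℓ)
    (V : Module (FiniteField.commutativeRing K) m ℓm) →
    let open Subspaces K V in
    HasDim whole n →
    (𝓕 : Family p k) → IsMaximumAlmostIntersecting t 𝓕 →
    ∃ λ (E : Gr p t) → ∀ (F : Gr p k) → F ∈ᶠ 𝓕 ⇔ E ≤ˢ F
-- No field has 0 elements, as its zero would have an index in `Fin 0`.
theorem1p1 zero n k t _ _ _ _ _ _ K _ _ _ _ = ⊥-elim (empty (Inverse.to enumeration 0#))
  where
  open FiniteField K
  empty : Fin 0 → ⊥
  empty ()
theorem1p1 {p = p} (suc r) n k t _ _ _ _ t+1≤k size≤n K V V-dim 𝓕 maximum =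
  is-star k t t<k k≤n 𝓕 maximum (admissible k t t<k k≤n 𝓕 maximum size≤n)
  where
  open Correspondence p K V V-dim
  t<k : suc t ≤ k
  t<k = subst (_≤ k) (ℕ.+-comm t 1) t+1≤k
  k≤n : k ≤ n
  k≤n = ℕ.≤-trans (ℕ.≤-trans (ℕ.m≤m+n k (k + 0)) (ℕ.m≤m+n (2 * k) 1)) (ℕ.m+n≤o⇒m≤o (2 * k + 1) size≤n)
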